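{- Let $\ell$ be a positive integer, $\mathbb{K}$ a field, and let $a_{i,j}\in\mathbb{K}$ ($1\le i\le \ell+1$, $j\in\mathbb{N}_0$) be constants with $a_{\ell,j}\neq 0$ and $a_{\ell+1,j}\neq 0$ for all $j\in\mathbb{N}_0$. Let $(P_n(x))_{n=0}^\infty$ be the polynomials defined by $P_{ -1}(x)=0$, $P_n(x)=x^n$ for $n=0,\ldots,\ell-1$, and $$P_n(x)=-\sum_{i=1}^{\ell-1}a_{i,n-\ell}P_{n-i}(x)+(x^{\ell}-a_{\ell,n-\ell})P_{n-\ell}(x)-a_{\ell+1,n-\ell}x^{\ell}P_{n-\ell-1}(x),\qquad n\geq \ell.$$ Let $\mathcal{L}\colon\mathbb{K}[x,x^{ -1}]\to\mathbb{K}$ be the unique linear functional such that $(P_n(x))_{n=0}^\infty$ is an $\ell$-LBPs with respect to $\mathcal{L}$ and such that $\mathcal{L}[1]=1$. Then the moments $\mu_n=\mathcal{L}[x^n]$ ($n\in\mathbb{Z}$) are given by $$\mu_n=\begin{cases} a_{\ell,0}\,w(\mathcal{B}_{n-\ell}), & \text{if } n\ge \ell,\\ 0, & \text{if } 1\le n\le \ell-1,\\ (-1)^{n\bmod \ell}\,w(\widetilde{\mathcal{B}}_{ -n}), & \text{if } n\le 0.\end{cases}$$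
   Context: $\mathbb{N}_0$ is the set of non-negative integers. For $p\in\mathbb{Z}$ and a positive integer $q$, $p\bmod q\in\{0,\ldots,q-1\}$ is the remainder of dividing $p$ by $q$. A sequence of monic polynomials $(P_n(x))_{n=0}^\infty$ over $\mathbb{K}$, with $P_n$ of exact degree $n$, is an $\ell$-LBPs ($\ell$-Laurent bi-orthogonal polynomials) with respect to a linear functional $\mathcal{L}\colon\mathbb{K}[x,x^{ -1}]\to\mathbb{K}$ if there are constants $h_n\ne 0$ with $\mathcal{L}[P_n(x)x^{ -k\ell}]=h_n\delta_{n,k}$ for all $n,k\in\mathbb{N}_0$ with $0\le k\le n$. (For the sequence $(P_n)$ of the claim, a functional with this property and $\mathcal{L}[1]=1$ exists and is unique.) Paths. A path is a finite (possibly empty) word over a finite set of steps (integer vectors in the $x$-$y$ plane) together with an initial point in $\mathbb{Z}^2$; it goes from its initial point to its final point (initial point plus the sum of its steps). The weight of a path is the product of the weights of its steps, where the weight of a step may depend on the point $(s,t)$ at which that step starts; the empty path has weight $1$. An $\ell$-Schröder path is a path with steps $\mathsf{a}_i=(i,\ell-i)$ for $i=0,\ldots,\ell$ and $\mathsf{a}_{\ell+1}=(1,-1)$, never going below the $x$-axis. Weights of steps: $w(\mathsf{a}_0,(s,t))=1$ and $w(\mathsf{a}_i,(s,t))=a_{i,t}$ for $i=1,\ldots,\ell+1$. A dual $\ell$-Schröder path is a path with steps $\mathsf{A}_i=(\ell-i,\ell-i)$ for $i=0,\ldots,\ell-1$, $\mathsf{A}_\ell=(\ell,0)$ and $\mathsf{A}_{\ell+1}=(\ell-1,-1)$,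 never going below the $x$-axis. Weights of steps: $w(\mathsf{A}_0,(s,t))=\frac{(-1)^{\ell+1}}{a_{\ell,t}}$; $w(\mathsf{A}_i,(s,t))=\frac{(-1)^{\ell+1+i}a_{i,t}}{a_{\ell,t}}$ for $1\le i\le \ell-1$ and for $i=\ell+1$; $w(\mathsf{A}_\ell,(s,t))=\frac{1}{a_{\ell,t}}$. For $n\in\mathbb{N}_0$, $\mathcal{B}_n$ is the set of $\ell$-Schröder paths from $(0,n\bmod\ell)$ to $(n,0)$, and $\widetilde{\mathcal{B}}_n$ is the set of dual $\ell$-Schröder paths from $(0,(-n)\bmod \ell)$ to $(n,0)$. Put $w(\mathcal{B}_n)=\sum_{\omega\in\mathcal{B}_n}w(\omega)$ and $w(\widetilde{\mathcal{B}}_n)=\sum_{\omega\in\widetilde{\mathcal{B}}_n}w(\omega)$. -}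

module Defs where

open import Algebra.Apartness.Bundles using (HeytingCommutativeRing; HeytingField)
open import Algebra.Bundles using (CommutativeRing)
open import Algebra.Module.Bundles.Raw using (RawLeftModule)
import Algebra.Module.Construct.TensorUnit as TensorUnit
open import Algebra.Module.Morphism.Structures using (module LeftModuleMorphisms)
import Algebra.Apartness.Properties.HeytingCommutativeRing as HeytingProperties
import Algebra.Properties.Semiring.Exp as SemiringExp
open import Data.Bool.Base using (if_then_else_; true; false; T)
open import Data.Fin.Base using (Fin; toℕ)
open import Data.Integer.Base as ℤ using (ℤ; +_; 0ℤ; 1ℤ; -1ℤ; ∣_∣; _%ℕ_)
import Data.Integer.Properties as ℤ
open import Data.Integer.Tactic.RingSolver using (solve-∀)
open import Data.List.Base
  using (List; []; _∷_; _++_; foldl; foldr; length; map; filter; cartesianProductWith; allFin; upTo)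
open import Data.List.Membership.Propositional using (_∈_)
open import Data.List.Membership.Propositional.Properties
  using (∈-allFin; ∈-cartesianProductWith⁺; ∈-cartesianProductWith⁻; ∈-filter⁺; ∈-filter⁻; ∈-map⁺)
open import Data.List.Properties using (∷-injective)
open import Data.List.Relation.Unary.All as All using (All)
open import Data.List.Relation.Unary.Any using (here; there)
open import Data.List.Relation.Unary.Unique.Propositional using (Unique)
import Data.List.Relation.Unary.Unique.Propositional.Properties as Unique
open import Data.List.Relation.Unary.AllPairs using ([]; _∷_)
open import Data.List.Scans.Base using (scanl)
open import Data.Nat.Base as ℕ using (ℕ; zero; suc; NonZero; s≤s; _≤ᵇ_; _<ᵇ_; _≡ᵇ_)
import Data.Nat.Properties as ℕ
open import Data.Product.Base using (_×_; _,_; proj₁; proj₂)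
open import Data.Product.Properties using (≡-dec)
open import Data.Sum.Base using (_⊎_)
open import Data.Unit.Base using (tt)
open import Level using (Level; _⊔_)
open import Relation.Binary.PropositionalEquality using (_≡_; refl; sym; trans; cong; subst; subst₂)
open import Relation.Nullary.Decidable using (Dec; does; _×-dec_)
open import Relation.Unary using (Pred; Decidable)

record Enumeration {a p : Level} {A : Set a} (P : Pred A p) : Set (a ⊔ p) where
  field
    elements : List A
    unique   : Unique elements
    sound    : ∀ {x} → x ∈ elements → P x
    complete : ∀ {x} → P x → x ∈ elements

Point : Set
Point = ℤ × ℤ

infixl 6 _⊕_
_⊕_ : Point → Point → Point
(x , y) ⊕ (x′ , y′) = x ℤ.+ x′ , y ℤ.+ y′

-- Words are over step labels. In both step sets used below, distinct labels
-- have distinct step vectors, so these are words over the vectors as well.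
infix 5 _▹_
record Path (m : ℕ) : Set where
  constructor _▹_
  field
    start : Point
    word  : List (Fin m)

module LatticePaths {m : ℕ} (step : Fin m → Point) where

  vertices : Path m → List Point
  vertices (p ▹ w) = scanl (λ q i → q ⊕ step i) p w

  final : Path m → Point
  final (p ▹ w) = foldl (λ q i → q ⊕ step i) p w

  NeverBelow : Path m → Set
  NeverBelow π = All (λ q → 0ℤ ℤ.≤ proj₂ q) (vertices π)

  Between : Point → Point → Pred (Path m) _
  Between p q π = Path.start π ≡ p × final π ≡ q × NeverBelow π

  -- If a linear form increases by at least 1 along each step, there are only
  -- finitely many paths between two given points.
  module Finiteness
    (α β : ℤ)
    (increase : ∀ i → 1ℤ ℤ.≤ α ℤ.* proj₁ (step i) ℤ.+ β ℤ.* proj₂ (step i))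
    where

    private
      _≟ₚ_ : (p q : Point) → Dec (p ≡ q)
      _≟ₚ_ = ≡-dec ℤ._≟_ ℤ._≟_

      Between? : ∀ p q → Decidable (Between p q)
      Between? p q π =
        (Path.start π ≟ₚ p) ×-dec (final π ≟ₚ q) ×-dec All.all? (λ r → 0ℤ ℤ.≤? proj₂ r) (vertices π)

      φ : Point → ℤ
      φ (x , y) = α ℤ.* x ℤ.+ β ℤ.* y

      φ-⊕ : ∀ p q → φ (p ⊕ q) ≡ φ q ℤ.+ φ p
      φ-⊕ (x , y) (x′ , y′) = lemma α β x y x′ y′
        where
        lemma : ∀ α β x y x′ y′ →
                α ℤ.* (x ℤ.+ x′) ℤ.+ β ℤ.* (y ℤ.+ y′) ≡
                (α ℤ.* x′ ℤ.+ β ℤ.* y′) ℤ.+ (α ℤ.* x ℤ.+ β ℤ.* y)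
        lemma = solve-∀

      length-≤ : ∀ p w → + length w ℤ.+ φ p ℤ.≤ φ (final (p ▹ w))
      length-≤ p []      = ℤ.≤-reflexive (ℤ.+-identityˡ (φ p))
      length-≤ p (i ∷ w) = begin
        + suc (length w) ℤ.+ φ p              ≡⟨ shift (+ length w) (φ p) ⟩
        + length w ℤ.+ (1ℤ ℤ.+ φ p)           ≤⟨ ℤ.+-monoʳ-≤ (+ length w) (ℤ.+-monoˡ-≤ (φ p) (increase i)) ⟩
        + length w ℤ.+ (φ (step i) ℤ.+ φ p)   ≡⟨ cong (ℤ._+_ (+ length w)) (φ-⊕ p (step i)) ⟨
        + length w ℤ.+ φ (p ⊕ step i)         ≤⟨ length-≤ (p ⊕ step i) w ⟩
        φ (final (p ▹ (i ∷ w)))               ∎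
        where
        open ℤ.≤-Reasoning
        shift : ∀ k z → (1ℤ ℤ.+ k) ℤ.+ z ≡ k ℤ.+ (1ℤ ℤ.+ z)
        shift = solve-∀

      bound : Point → Point → ℕ
      bound p q = ∣ φ q ℤ.- φ p ∣

      length-bound : ∀ p w → length w ℕ.≤ bound p (final (p ▹ w))
      length-bound p w = ℤ.drop‿+≤+ (ℤ.≤-trans l≤d (ℤ.≤-reflexive (sym (ℤ.0≤i⇒+∣i∣≡i (ℤ.≤-trans (ℤ.+≤+ ℕ.z≤n) l≤d)))))
        where
        cancel : ∀ k z → (k ℤ.+ z) ℤ.+ ℤ.- z ≡ k
        cancel = solve-∀
        l≤d : + length w ℤ.≤ φ (final (p ▹ w)) ℤ.- φ p
        l≤d = subst (ℤ._≤ φ (final (p ▹ w)) ℤ.- φ p) (cancel (+ length w) (φ p))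
                (ℤ.+-monoˡ-≤ (ℤ.- φ p) (length-≤ p w))

      words : ℕ → List (List (Fin m))
      words zero    = [] ∷ []
      words (suc N) = [] ∷ cartesianProductWith _∷_ (allFin m) (words N)

      words-unique : ∀ N → Unique (words N)
      words-unique zero    = All.[] ∷ []
      words-unique (suc N) =
        All.tabulate nonempty ∷
        Unique.cartesianProductWith⁺ _∷_ ∷-injective (Unique.allFin⁺ m) (words-unique N)
        where
        nonempty : ∀ {w} → w ∈ cartesianProductWith _∷_ (allFin m) (words N) → [] ≡ w → _
        nonempty w∈ refl with ∈-cartesianProductWith⁻ _∷_ (allFin m) (words N) w∈
        ... | _ , _ , _ , _ , ()

      ∈-words : ∀ N w → length w ℕ.≤ N → w ∈ words N
      ∈-words zero    []      _         = here refl
      ∈-words (suc N) []      _         = here refl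
      ∈-words (suc N) (i ∷ w) (s≤s l≤N) =
        there (∈-cartesianProductWith⁺ _∷_ (∈-allFin i) (∈-words N w l≤N))

      candidates : Point → Point → List (Path m)
      candidates p q = map (p ▹_) (words (bound p q))

    enumeration : ∀ p q → Enumeration (Between p q)
    enumeration p q = record
      { elements = filter (Between? p q) (candidates p q)
      ; unique   = Unique.filter⁺ (Between? p q)
                     (Unique.map⁺ (λ { refl → refl }) (words-unique (bound p q)))
      ; sound    = λ π∈ → proj₂ (∈-filter⁻ (Between? p q) {xs = candidates p q} π∈)
      ; complete = complete
      }
      where
      complete : ∀ {π} → Between p q π → π ∈ filter (Between? p q) (candidates p q)
      complete {.p ▹ w} b@(refl , refl , _) =
        ∈-filter⁺ (Between? p q) (∈-map⁺ (p ▹_) (∈-words (bound p q) w (length-bound p w))) b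

-- Label i stands for the step aᵢ (resp. Aᵢ), i = 0, …, ℓ + 1.
module _ (ℓ : ℕ) where

  schröderStep : Fin (2 ℕ.+ ℓ) → Point
  schröderStep j = let i = toℕ j in
    if i ≤ᵇ ℓ then (+ i , + ℓ ℤ.- + i)
    else (1ℤ , -1ℤ)

  dualSchröderStep : Fin (2 ℕ.+ ℓ) → Point
  dualSchröderStep j = let i = toℕ j in
    if i <ᵇ ℓ then (+ ℓ ℤ.- + i , + ℓ ℤ.- + i)
    else if i ≡ᵇ ℓ then (+ ℓ , 0ℤ)
    else (+ ℓ ℤ.- 1ℤ , -1ℤ)

module _ (ℓ : ℕ) .{{_ : NonZero ℓ}} where

  private
    module S  = LatticePaths (schröderStep ℓ)
    module S̃ = LatticePaths (dualSchröderStep ℓ)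

    1≤ℓ : 1ℤ ℤ.≤ + ℓ
    1≤ℓ = ℤ.+≤+ (ℕ.>-nonZero⁻¹ ℓ)

    schröder-increase : ∀ i → 1ℤ ℤ.≤ (+ 2) ℤ.* proj₁ (schröderStep ℓ i) ℤ.+ 1ℤ ℤ.* proj₂ (schröderStep ℓ i)
    schröder-increase j with toℕ j ≤ᵇ ℓ
    ... | true  = subst (1ℤ ℤ.≤_) (lemma (+ toℕ j) (+ ℓ)) (ℤ.+-mono-≤ (ℤ.+≤+ (ℕ.z≤n {toℕ j})) 1≤ℓ)
      where
      lemma : ∀ i ℓ → i ℤ.+ ℓ ≡ (+ 2) ℤ.* i ℤ.+ 1ℤ ℤ.* (ℓ ℤ.+ ℤ.- i)
      lemma = solve-∀
    ... | false = ℤ.≤-refl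

    dual-increase : ∀ i → 1ℤ ℤ.≤ (+ 2) ℤ.* proj₁ (dualSchröderStep ℓ i) ℤ.+ -1ℤ ℤ.* proj₂ (dualSchröderStep ℓ i)
    dual-increase j with toℕ j <ᵇ ℓ in eq
    ... | true  = subst₂ ℤ._≤_ (one (+ toℕ j)) (lemma (+ toℕ j) (+ ℓ))
                    (ℤ.+-monoˡ-≤ (ℤ.- + toℕ j) (ℤ.+≤+ (ℕ.<ᵇ⇒< (toℕ j) ℓ (subst T (sym eq) tt))))
      where
      one : ∀ i → (1ℤ ℤ.+ i) ℤ.+ ℤ.- i ≡ 1ℤ
      one = solve-∀
      lemma : ∀ i ℓ → ℓ ℤ.+ ℤ.- i ≡ (+ 2) ℤ.* (ℓ ℤ.+ ℤ.- i) ℤ.+ -1ℤ ℤ.* (ℓ ℤ.+ ℤ.- i)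
      lemma = solve-∀
    ... | false with toℕ j ≡ᵇ ℓ
    ...   | true  = subst (1ℤ ℤ.≤_) (lemma (+ ℓ)) (ℤ.+-mono-≤ 1≤ℓ (ℤ.+≤+ (ℕ.z≤n {ℓ})))
      where
      lemma : ∀ ℓ → ℓ ℤ.+ ℓ ≡ (+ 2) ℤ.* ℓ ℤ.+ -1ℤ ℤ.* 0ℤ
      lemma = solve-∀
    ...   | false = subst (1ℤ ℤ.≤_) (lemma (+ ℓ)) (ℤ.+-monoˡ-≤ -1ℤ (ℤ.+-mono-≤ 1≤ℓ 1≤ℓ))
      where
      lemma : ∀ ℓ → (ℓ ℤ.+ ℓ) ℤ.+ -1ℤ ≡ (+ 2) ℤ.* (ℓ ℤ.+ ℤ.- 1ℤ) ℤ.+ -1ℤ ℤ.* -1ℤ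
      lemma = solve-∀

  𝓑 : ℕ → Pred (Path (2 ℕ.+ ℓ)) _
  𝓑 n = S.Between (0ℤ , + (+ n %ℕ ℓ)) (+ n , 0ℤ)

  𝓑̃ : ℕ → Pred (Path (2 ℕ.+ ℓ)) _
  𝓑̃ n = S̃.Between (0ℤ , + ((ℤ.- + n) %ℕ ℓ)) (+ n , 0ℤ)

  𝓑-enum : ∀ n → Enumeration (𝓑 n)
  𝓑-enum n = S.Finiteness.enumeration (+ 2) 1ℤ schröder-increase _ _

  𝓑̃-enum : ∀ n → Enumeration (𝓑̃ n)
  𝓑̃-enum n = S̃.Finiteness.enumeration (+ 2) -1ℤ dual-increase _ _

-- A field is a Heyting field: x # 0# is the constructive form of x ≠ 0. For
-- a field with decidable equality, # is the negation of ≈.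
module OverField {c r₁ r₂} (K : HeytingField c r₁ r₂) where

  open HeytingField K renaming (refl to ≈-refl; sym to ≈-sym; trans to ≈-trans)
  open HeytingCommutativeRing heytingCommutativeRing using (commutativeRing)
  open CommutativeRing commutativeRing using (rawRing; semiring)
  open SemiringExp semiring using (_^_)

  -- #⇒invertible provides an inverse of x - 0#.
  recip : ∀ x → x # 0# → Carrier
  recip x x#0 = proj₁ (#⇒invertible x#0)

  recip-inverseʳ : ∀ x (x#0 : x # 0#) → x * recip x x#0 ≈ 1#
  recip-inverseʳ x x#0 =
    ≈-trans (*-congʳ (≈-sym (x-0≈x x))) (proj₂ (proj₂ (#⇒invertible x#0)))
    where open HeytingProperties heytingCommutativeRing using (x-0≈x)

  sgn : ℕ → Carrier
  sgn k = (- 1#) ^ k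

  δ : ℕ → ℕ → Carrier
  δ n k = if n ≡ᵇ k then 1# else 0#

  -- K[x,x⁻¹]: a Laurent polynomial is a formal sum of terms c xᵏ, given as
  -- pairs (k , c); exponents may repeat, and equality ≋ is equality of all
  -- coefficients. K[x] is the part without negative exponents.

  Laurent : Set c
  Laurent = List (ℤ × Carrier)

  coeff : Laurent → ℤ → Carrier
  coeff []            k = 0#
  coeff ((j , c) ∷ f) k = (if does (j ℤ.≟ k) then c else 0#) + coeff f k

  infix 4 _≋_
  _≋_ : Laurent → Laurent → Set r₁
  f ≋ g = ∀ k → coeff f k ≈ coeff g k

  0ᴸ : Laurent
  0ᴸ = []

  const : Carrier → Laurent
  const c = (0ℤ , c) ∷ []

  x^_ : ℤ → Laurent
  x^ k = (k , 1#) ∷ []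

  infix  8 -ᴸ_
  infixl 7 _·ᴸ_
  infixl 6 _+ᴸ_ _-ᴸ_

  _+ᴸ_ : Laurent → Laurent → Laurent
  _+ᴸ_ = _++_

  -ᴸ_ : Laurent → Laurent
  -ᴸ_ = map (λ (k , c) → k , - c)

  _-ᴸ_ : Laurent → Laurent → Laurent
  f -ᴸ g = f +ᴸ -ᴸ g

  _·ᴸ_ : Laurent → Laurent → Laurent
  _·ᴸ_ = cartesianProductWith (λ (j , c) (k , d) → j ℤ.+ k , c * d)

  ∑ᴸ : List ℕ → (ℕ → Laurent) → Laurent
  ∑ᴸ is f = foldr (λ i s → f i +ᴸ s) 0ᴸ is

  laurentModule : RawLeftModule Carrier c r₁
  laurentModule = record
    { Carrierᴹ = Laurent
    ; _≈ᴹ_     = _≋_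
    ; _+ᴹ_     = _+ᴸ_
    ; _*ₗ_     = λ b → map (λ (k , c) → k , b * c)
    ; 0ᴹ       = 0ᴸ
    ; -ᴹ_      = -ᴸ_
    }

  IsLinearFunctional : (Laurent → Carrier) → Set (c ⊔ r₁)
  IsLinearFunctional =
    LeftModuleMorphisms.IsLeftModuleHomomorphism laurentModule (TensorUnit.rawLeftModule {R = rawRing})

  MonicOfDegree : ℕ → Laurent → Set r₁
  MonicOfDegree n f =
    coeff f (+ n) ≈ 1# × (∀ k → k ℤ.< 0ℤ ⊎ + n ℤ.< k → coeff f k ≈ 0#)

  record IsLBP (ℓ : ℕ) (P : ℕ → Laurent) (L : Laurent → Carrier) : Set (c ⊔ r₁ ⊔ r₂) where
    field
      monic      : ∀ n → MonicOfDegree n (P n)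
      h          : ℕ → Carrier
      h#0        : ∀ n → h n # 0#
      orthogonal : ∀ n k → k ℕ.≤ n → L (P n ·ᴸ x^ (ℤ.- + (k ℕ.* ℓ))) ≈ h n * δ n k

  -- Only the values of a i for 1 ≤ i ≤ ℓ + 1, and of P from -1 on, are used.
  record IsRecurrenceSolution (ℓ : ℕ) (a : ℕ → ℕ → Carrier) (P : ℤ → Laurent) : Set r₁ where
    field
      P₋₁     : P -1ℤ ≋ 0ᴸ
      initial : ∀ n → n ℕ.< ℓ → P (+ n) ≋ x^ (+ n)
      recur   : ∀ n → ℓ ℕ.≤ n →
        P (+ n) ≋
          -ᴸ ∑ᴸ (map suc (upTo (ℓ ℕ.∸ 1))) (λ i → const (a i (n ℕ.∸ ℓ)) ·ᴸ P (+ n ℤ.- + i))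
          +ᴸ (x^ (+ ℓ) -ᴸ const (a ℓ (n ℕ.∸ ℓ))) ·ᴸ P (+ n ℤ.- + ℓ)
          -ᴸ const (a (suc ℓ) (n ℕ.∸ ℓ)) ·ᴸ x^ (+ ℓ) ·ᴸ P (+ n ℤ.- + ℓ ℤ.- 1ℤ)

  module _ {m : ℕ} (step : Fin m → Point) (weight : Fin m → Point → Carrier) where

    wordWeight : Point → List (Fin m) → Carrier
    wordWeight p []      = 1#
    wordWeight p (i ∷ w) = weight i p * wordWeight (p ⊕ step i) w

    pathWeight : Path m → Carrier
    pathWeight (p ▹ w) = wordWeight p w

  totalWeight : ∀ {m p} {P : Pred (Path m) p} → Enumeration P → (Path m → Carrier) → Carrier
  totalWeight e w = foldr (λ π s → w π + s) 0# (Enumeration.elements e)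

  -- The height t of a point is an integer; steps of a path that never goes
  -- below the x-axis start at t ≥ 0, where ∣ t ∣ is t.
  module Weights (ℓ : ℕ) .{{_ : NonZero ℓ}} (a : ℕ → ℕ → Carrier) (aℓ#0 : ∀ j → a ℓ j # 0#) where

    schröderWeight : Fin (2 ℕ.+ ℓ) → Point → Carrier
    schröderWeight j (s , t) = let i = toℕ j in
      if i ≡ᵇ 0 then 1# else a i ∣ t ∣

    dualSchröderWeight : Fin (2 ℕ.+ ℓ) → Point → Carrier
    dualSchröderWeight j (s , t) = let i = toℕ j ; 1/aℓ = recip (a ℓ ∣ t ∣) (aℓ#0 ∣ t ∣) in
      if i ≡ᵇ 0 then sgn (ℓ ℕ.+ 1) * 1/aℓ
      else if i ≡ᵇ ℓ then 1/aℓ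
      else sgn (ℓ ℕ.+ 1 ℕ.+ i) * a i ∣ t ∣ * 1/aℓ

    w𝓑 : ℕ → Carrier
    w𝓑 n = totalWeight (𝓑-enum ℓ n) (pathWeight (schröderStep ℓ) schröderWeight)

    w𝓑̃ : ℕ → Carrier
    w𝓑̃ n = totalWeight (𝓑̃-enum ℓ n) (pathWeight (dualSchröderStep ℓ) dualSchröderWeight)

{-# OPTIONS --safe #-}
-- Put Φ(z,t) = L[xᶻ P_t]. With a_{0,t} = 1 the recurrence reads
--   x^ℓ P_t = Σ_{0≤i≤ℓ} a_{i,t} P_{t+ℓ-i} + a_{ℓ+1,t} x^ℓ P_{t-1}.
-- Multiplied by x^{kℓ} and with L applied, this is the decomposition of weighted
-- ℓ-Schröder paths by their first step: x^{kℓ} P_t stands for a point at height t, and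
-- k drops exactly along the non-descending steps. Orthogonality, Φ(0,t) = δ_{t,0}, leaves
-- at the end only a last step a_ℓ from height 0, whence the factor a_{ℓ,0}.
-- Solving the same relation for P_t gives dual paths for negative exponents. There
-- Φ(-kℓ,t) = 0 for t > k by orthogonality, and the path sums vanish in the same range
-- because at most k descents remain; the factor (-1)^t accounts for the signs of the
-- dual weights.
module Submission where

open import Defs
open import Algebra.Apartness.Bundles using (HeytingField; HeytingCommutativeRing)
open import Algebra.Bundles using (CommutativeRing)
open import Algebra.Module.Morphism.Structures using (module LeftModuleMorphisms)
import Algebra.Properties.Ring as RingProperties
import Algebra.Properties.Semiring.Exp as SemiringExp
import Algebra.Properties.Semiring.Sum as SemiringSum
import Algebra.Solver.CommutativeMonoid as CommutativeMonoidSolver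
open import Data.Bool.Base using (if_then_else_; true; false; T)
open import Data.Empty using (⊥-elim)
open import Data.Fin.Base using (Fin; zero; suc; toℕ; fromℕ; inject₁)
import Data.Fin.Properties as Fin
open import Data.Integer.Base as ℤ using (ℤ; +_; 0ℤ; 1ℤ; ∣_∣; _%ℕ_; -1ℤ; -[1+_]; _/ℕ_)
import Data.Integer.DivMod as ℤ
import Data.Integer.Properties as ℤ
open import Data.Integer.Tactic.RingSolver using (solve-∀)
open import Data.List.Base using (List; []; _∷_; _++_; concat; foldr; map; tabulate; upTo; applyUpTo)
open import Data.List.Membership.Propositional using (_∈_; _∉_)
open import Data.List.Membership.Propositional.Properties
  using (∈-++⁺ʳ; ∈-++⁻; ∈-concat⁺′; ∈-concat⁻′; ∈-map⁺; ∈-map⁻; ∈-tabulate⁺; ∈-tabulate⁻)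
open import Data.List.Membership.Propositional.Properties.WithK using (unique∧set⇒bag)
open import Data.List.Relation.Binary.BagAndSetEquality using (∼bag⇒↭)
open import Data.List.Relation.Binary.Permutation.Propositional as Perm using (_↭_)
open import Data.List.Relation.Unary.All as All using (All; []; _∷_)
import Data.List.Relation.Unary.All.Properties as All
open import Data.List.Relation.Unary.AllPairs using ([]; _∷_)
import Data.List.Relation.Unary.AllPairs.Properties as AllPairs
open import Data.List.Relation.Unary.Any using (here)
open import Data.List.Relation.Unary.Unique.Propositional using (Unique)
import Data.List.Relation.Unary.Unique.Propositional.Properties as Unique
open import Data.Nat.Base as ℕ using (ℕ; suc; NonZero)
import Data.Nat.DivMod as ℕ
import Data.Nat.Properties as ℕ
open import Data.Product.Base using (_×_; _,_; proj₁; proj₂; Σ)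
open import Data.Sum.Base using (_⊎_; inj₁; inj₂)
open import Data.Unit.Base using (tt)
open import Function.Base using (_∘_)
open import Function.Bundles using (mk⇔)
open import Relation.Binary.PropositionalEquality as ≡ using (_≡_; _≢_)
open import Relation.Nullary using (¬_; Dec; yes; no; does)
open import Relation.Nullary.Decidable using (does-⇔)
open import Relation.Unary using (Pred)

-- Linear forms along lattice paths.

form : ℤ → ℤ → Point → ℤ
form α β (x , y) = α ℤ.* x ℤ.+ β ℤ.* y

form-⊕ : ∀ α β p q → form α β (p ⊕ q) ≡ form α β p ℤ.+ form α β q
form-⊕ α β (x , y) (x′ , y′) = lemma α β x y x′ y′
  where
  lemma : ∀ α β x y x′ y′ →
          α ℤ.* (x ℤ.+ x′) ℤ.+ β ℤ.* (y ℤ.+ y′) ≡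
          (α ℤ.* x ℤ.+ β ℤ.* y) ℤ.+ (α ℤ.* x′ ℤ.+ β ℤ.* y′)
  lemma = solve-∀

module Paths {m : ℕ} (step : Fin m → Point) where
  open LatticePaths step public

  form-final : ∀ α β → (∀ i → 0ℤ ℤ.≤ form α β (step i)) →
               ∀ p w → form α β p ℤ.≤ form α β (final (p ▹ w))
  form-final α β mono p []      = ℤ.≤-refl
  form-final α β mono p (i ∷ w) = ℤ.≤-trans
    (≡.subst₂ ℤ._≤_ (ℤ.+-identityʳ _) (≡.sym (form-⊕ α β p (step i))) (ℤ.+-monoʳ-≤ (form α β p) (mono i)))
    (form-final α β mono (p ⊕ step i) w)

  -- Rules out paths to unreachable targets. For Schröder paths the form is x + y (`V-0`), for dual
  -- paths x + (ℓ - 1) y (`U-vanishes`).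
  ¬Between-form : ∀ α β → (∀ i → 0ℤ ℤ.≤ form α β (step i)) →
                  ∀ p q → form α β q ℤ.< form α β p → ∀ π → ¬ Between p q π
  ¬Between-form α β mono p _ q<p (_ ▹ w) (≡.refl , ≡.refl , _) = ℤ.<⇒≱ q<p (form-final α β mono p w)

  ¬Between-below : ∀ p q → ¬ 0ℤ ℤ.≤ proj₂ p → ∀ π → ¬ Between p q π
  -- The first vertex is `p` in both cases; `vertices` exposes it only once the word is split.
  ¬Between-below p q below (_ ▹ [])    (≡.refl , _ , 0≤y ∷ _) = below 0≤y
  ¬Between-below p q below (_ ▹ (_ ∷ _)) (≡.refl , _ , 0≤y ∷ _) = below 0≤y

-- Decomposition of paths by their first step.

module FirstStep {m : ℕ} (step : Fin m → Point) (p q : Point) (0≤y : 0ℤ ℤ.≤ proj₂ p)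
                 (e : ∀ i → Enumeration (LatticePaths.Between step (p ⊕ step i) q)) where
  open LatticePaths step

  cons : Fin m → Path m → Path m
  cons i (_ ▹ w) = p ▹ (i ∷ w)

  stationary : Dec (p ≡ q) → List (Path m)
  stationary (yes _) = (p ▹ []) ∷ []
  stationary (no  _) = []

  startingWith : Fin m → List (Path m)
  startingWith i = map (cons i) (Enumeration.elements (e i))

  -- `cons i` discards the start of its argument, so it is injective only among paths with a common
  -- start; hence the hypothesis on the starts.
  cons-unique : ∀ i {πs} → All (λ π → Path.start π ≡ p ⊕ step i) πs → Unique πs → Unique (map (cons i) πs)
  cons-unique i []              []           = []
  cons-unique i {(r ▹ w) ∷ _} (start≡ ∷ starts) (∉πs ∷ πs!) =
    All.map⁺ (All.zipWith distinct (starts , ∉πs)) ∷ cons-unique i starts πs!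
    where
    distinct : ∀ {π} → Path.start π ≡ p ⊕ step i × (r ▹ w) ≢ π → cons i (r ▹ w) ≢ cons i π
    distinct {r′ ▹ w′} (start≡′ , π≢) ≡.refl = π≢ (≡.cong (_▹ w) (≡.trans start≡ (≡.sym start≡′)))

  -- A path is empty, which forces `p ≡ q`, or it is a step followed by a path from `p ⊕ step i`.
  -- The decision is an argument so that a caller can settle it by its own proof.
  first-step : Dec (p ≡ q) → Enumeration (Between p q)
  first-step p≟q = record
    { elements = stationary p≟q ++ concat (tabulate startingWith)
    ; unique   = Unique.++⁺ (stationary-unique p≟q)
                   (Unique.concat⁺
                     (All.tabulate⁺ λ i → cons-unique i
                       (All.tabulate (proj₁ ∘ Enumeration.sound (e i))) (Enumeration.unique (e i)))
                     -- The first letter of the word recovers the label, so distinct labels give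
                     -- disjoint lists.
                     (AllPairs.tabulate⁺ λ i≢j (∈i , ∈j) → i≢j (disjoint ∈i ∈j)))
                   λ (∈s , ∈c) → stationary-disjoint p≟q ∈s ∈c
    ; sound    = sound p≟q ∘ ∈-++⁻ (stationary p≟q)
    ; complete = complete p≟q
    }
    where
    stationary-unique : ∀ d → Unique (stationary d)
    stationary-unique (yes _) = [] ∷ []
    stationary-unique (no  _) = []

    disjoint : ∀ {i j π} → π ∈ startingWith i → π ∈ startingWith j → i ≡ j
    disjoint {i} {j} ∈i ∈j with ∈-map⁻ (cons i) ∈i | ∈-map⁻ (cons j) ∈j
    ... | _ , _ , ≡.refl | _ , _ , ≡.refl = ≡.refl

    stationary-word : ∀ d {π} → π ∈ stationary d → Path.word π ≡ []
    stationary-word (yes _) (here ≡.refl) = ≡.refl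

    stationary-disjoint : ∀ d {π} → π ∈ stationary d → π ∉ concat (tabulate startingWith)
    stationary-disjoint d ∈s ∈c with ∈-concat⁻′ (tabulate startingWith) ∈c
    ... | _ , ∈i , i∈ with ∈-tabulate⁻ i∈
    ...   | i , ≡.refl with ∈-map⁻ (cons i) ∈i
    ...     | _ , _ , ≡.refl with () ← stationary-word d ∈s

    sound : ∀ d {π} → π ∈ stationary d ⊎ π ∈ concat (tabulate startingWith) → Between p q π
    sound (yes p≡q) (inj₁ (here ≡.refl)) = ≡.refl , p≡q , 0≤y ∷ []
    sound (no _)    (inj₁ ())
    sound _         (inj₂ ∈c) with ∈-concat⁻′ (tabulate startingWith) ∈c
    ... | _ , ∈i , i∈ with ∈-tabulate⁻ i∈
    ...   | i , ≡.refl with ∈-map⁻ (cons i) ∈i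
    ...     | _ , π∈ , ≡.refl with Enumeration.sound (e i) π∈
    ...       | ≡.refl , final≡ , above = ≡.refl , final≡ , 0≤y ∷ above

    complete : ∀ d {π} → Between p q π → π ∈ stationary d ++ concat (tabulate startingWith)
    complete (yes _)  {_ ▹ []} (≡.refl , _ , _)   = here ≡.refl
    complete (no p≢q) {_ ▹ []} (≡.refl , p≡q , _) = ⊥-elim (p≢q p≡q)
    complete d {_ ▹ (i ∷ w)} (≡.refl , final≡ , _ ∷ above) = ∈-++⁺ʳ (stationary d)
      (∈-concat⁺′ (∈-map⁺ (cons i) (Enumeration.complete (e i) (≡.refl , final≡ , above))) (∈-tabulate⁺ i))

-- Path sums and their transfer equation.

module TotalWeight {c r₁ r₂} (K : HeytingField c r₁ r₂) where
  open HeytingField K hiding (zero)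
  open OverField K
  open HeytingCommutativeRing heytingCommutativeRing using (commutativeRing)
  open CommutativeRing commutativeRing using (semiring)
  open SemiringSum semiring using (sum)
  open import Relation.Binary.Reasoning.Setoid setoid

  module _ {a} {A : Set a} where

    total : (A → Carrier) → List A → Carrier
    total f = foldr (λ x s → f x + s) 0#

    total-↭ : ∀ f {xs ys} → xs ↭ ys → total f xs ≈ total f ys
    total-↭ f Perm.refl            = refl
    total-↭ f (Perm.prep x eq)     = +-congˡ (total-↭ f eq)
    total-↭ f (Perm.swap {xs} {ys} x y eq) = begin
      f x + (f y + total f xs)  ≈⟨ +-assoc _ _ _ ⟨
      f x + f y + total f xs    ≈⟨ +-cong (+-comm _ _) (total-↭ f eq) ⟩
      f y + f x + total f ys    ≈⟨ +-assoc _ _ _ ⟩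
      f y + (f x + total f ys)  ∎
    total-↭ f (Perm.trans eq eq′)  = trans (total-↭ f eq) (total-↭ f eq′)

    total-++ : ∀ f xs ys → total f (xs ++ ys) ≈ total f xs + total f ys
    total-++ f []       ys = sym (+-identityˡ _)
    total-++ f (x ∷ xs) ys = trans (+-congˡ (total-++ f xs ys)) (sym (+-assoc _ _ _))

    total-concat-tabulate : ∀ f {n} (xss : Fin n → List A) →
      total f (concat (tabulate xss)) ≈ sum (λ i → total f (xss i))
    total-concat-tabulate f {ℕ.zero} xss = refl
    total-concat-tabulate f {suc n}  xss =
      trans (total-++ f (xss zero) _) (+-congˡ (total-concat-tabulate f (xss ∘ suc)))

  total-map : ∀ {a b} {A : Set a} {B : Set b} (f : A → Carrier) (g : B → Carrier) (h : B → A) c {xs} →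
    All (λ x → f (h x) ≈ c * g x) xs → total f (map h xs) ≈ c * total g xs
  total-map f g h c []         = sym (zeroʳ c)
  total-map f g h c (eq ∷ eqs) = trans (+-cong eq (total-map f g h c eqs)) (sym (distribˡ c _ _))

  module _ {m p} {P : Pred (Path m) p} where

    -- Two duplicate-free lists with the same members are permutations of each other. Thus a path
    -- sum may be computed from `first-step` although it is defined by another enumeration.
    totalWeight-unique : (e e′ : Enumeration P) → ∀ f → totalWeight e f ≈ totalWeight e′ f
    totalWeight-unique e e′ f = total-↭ f
      (∼bag⇒↭ (unique∧set⇒bag (unique e) (unique e′)
        (mk⇔ (complete e′ ∘ sound e) (complete e ∘ sound e′))))
      where
      open Enumeration

    totalWeight-empty : (e : Enumeration P) → (∀ π → ¬ P π) → ∀ f → totalWeight e f ≈ 0#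
    totalWeight-empty e empty f with Enumeration.elements e in eq
    ... | []    = refl
    ... | π ∷ _ = ⊥-elim (empty π (Enumeration.sound e (≡.subst (π ∈_) (≡.sym eq) (here ≡.refl))))

  module Transfer {m} (step : Fin m → Point) (weight : Fin m → Point → Carrier)
                  (enum : ∀ p q → Enumeration (LatticePaths.Between step p q)) where
    open Paths step

    ω = pathWeight step weight

    opaque
      -- Opaque: later arguments rest on `W-totalWeight` and `W-empty`, never on the list of paths
      -- itself.
      W : Point → Point → Carrier
      W p q = totalWeight (enum p q) ω

      W-totalWeight : ∀ {p q} (e : Enumeration (Between p q)) → W p q ≈ totalWeight e ω
      W-totalWeight {p} {q} e = totalWeight-unique (enum p q) e ω

      W-empty : ∀ p q → (∀ π → ¬ Between p q π) → W p q ≈ 0#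
      W-empty p q empty = totalWeight-empty (enum p q) empty ω

    -- The weight of the first step depends only on its label and on `p`, so it factors out of all
    -- paths that begin with that step.
    W-first-step : ∀ p q → 0ℤ ℤ.≤ proj₂ p → (p≟q : Dec (p ≡ q)) →
      W p q ≈ (if does p≟q then 1# else 0#) + sum (λ i → weight i p * W (p ⊕ step i) q)
    W-first-step p q 0≤y p≟q = begin
      W p q                                          ≈⟨ W-totalWeight (first-step p≟q) ⟩
      total ω (stationary p≟q ++ concat (tabulate startingWith))
        ≈⟨ total-++ ω (stationary p≟q) _ ⟩
      total ω (stationary p≟q) + total ω (concat (tabulate startingWith))
        ≈⟨ +-cong (stationary-weight p≟q) (trans (total-concat-tabulate ω startingWith) (sum-cong-≋ startingWith-weight)) ⟩
      (if does p≟q then 1# else 0#) + sum (λ i → weight i p * W (p ⊕ step i) q) ∎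
      where
      open FirstStep step p q 0≤y (λ i → enum (p ⊕ step i) q)
      open SemiringSum semiring using (sum-cong-≋)

      stationary-weight : ∀ d → total ω (stationary d) ≈ (if does d then 1# else 0#)
      stationary-weight (yes _) = +-identityʳ 1#
      stationary-weight (no  _) = refl

      startingWith-weight : ∀ i → total ω (startingWith i) ≈ weight i p * W (p ⊕ step i) q
      startingWith-weight i = trans
        (total-map ω ω (cons i) (weight i p)
          (All.tabulate λ {π} π∈ → cons-weight π (proj₁ (Enumeration.sound (enum (p ⊕ step i) q) π∈))))
        (*-congˡ (sym (W-totalWeight (enum (p ⊕ step i) q))))
        where
        cons-weight : ∀ π → Path.start π ≡ p ⊕ step i → ω (cons i π) ≈ weight i p * ω π
        cons-weight (_ ▹ w) ≡.refl = refl

-- Laurent polynomials under a linear functional.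

module LaurentAlgebra {c r₁ r₂} (K : HeytingField c r₁ r₂) where
  open HeytingField K hiding (zero)
  open OverField K
  open HeytingCommutativeRing heytingCommutativeRing using (commutativeRing)
  open CommutativeRing commutativeRing using (semiring; ring)
  open SemiringSum semiring using (sum)
  open RingProperties ring using (-0#≈0#; -‿+-comm)
  open import Relation.Binary.Reasoning.Setoid setoid

  coeff-+ : ∀ f g k → coeff (f +ᴸ g) k ≈ coeff f k + coeff g k
  coeff-+ []            g k = sym (+-identityˡ _)
  coeff-+ ((_ , _) ∷ f) g k = trans (+-congˡ (coeff-+ f g k)) (sym (+-assoc _ _ _))

  coeff-neg : ∀ f k → coeff (-ᴸ f) k ≈ - coeff f k
  coeff-neg []            k = sym -0#≈0#
  coeff-neg ((j , c) ∷ f) k = trans (+-cong (lemma (does (j ℤ.≟ k))) (coeff-neg f k)) (-‿+-comm _ _)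
    where
    lemma : ∀ b → (if b then - c else 0#) ≈ - (if b then c else 0#)
    lemma true  = refl
    lemma false = sym -0#≈0#

  shift-≟ : ∀ j i k → does (j ℤ.+ i ℤ.≟ k) ≡ does (i ℤ.≟ k ℤ.- j)
  shift-≟ j i k = does-⇔ (mk⇔ (λ { ≡.refl → to i j }) (λ { ≡.refl → from j k })) (j ℤ.+ i ℤ.≟ k) (i ℤ.≟ k ℤ.- j)
    where
    to : ∀ i j → i ≡ (j ℤ.+ i) ℤ.+ ℤ.- j
    to = solve-∀
    from : ∀ j k → j ℤ.+ (k ℤ.+ ℤ.- j) ≡ k
    from = solve-∀

  if-* : ∀ b c d → (if b then c * d else 0#) ≈ c * (if b then d else 0#)
  if-* true  c d = refl
  if-* false c d = sym (zeroʳ c)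

  coeff-map : ∀ j c g k → coeff (map (λ (i , d) → j ℤ.+ i , c * d) g) k ≈ c * coeff g (k ℤ.- j)
  coeff-map j c []            k = sym (zeroʳ c)
  coeff-map j c ((i , d) ∷ g) k = begin
    (if does (j ℤ.+ i ℤ.≟ k) then c * d else 0#) + coeff (map _ g) k
      ≡⟨ ≡.cong (λ b → (if b then c * d else 0#) + coeff (map _ g) k) (shift-≟ j i k) ⟩
    (if does (i ℤ.≟ k ℤ.- j) then c * d else 0#) + coeff (map _ g) k
      ≈⟨ +-cong (if-* _ c d) (coeff-map j c g k) ⟩
    c * (if does (i ℤ.≟ k ℤ.- j) then d else 0#) + c * coeff g (k ℤ.- j)
      ≈⟨ distribˡ c _ _ ⟨
    c * coeff ((i , d) ∷ g) (k ℤ.- j) ∎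

  coeff-∷-· : ∀ j c f g k → coeff (((j , c) ∷ f) ·ᴸ g) k ≈ c * coeff g (k ℤ.- j) + coeff (f ·ᴸ g) k
  coeff-∷-· j c f g k = trans (coeff-+ (map _ g) (f ·ᴸ g) k) (+-congʳ (coeff-map j c g k))

  coeff-mono-· : ∀ j c g k → coeff (((j , c) ∷ []) ·ᴸ g) k ≈ c * coeff g (k ℤ.- j)
  coeff-mono-· j c g k = trans (coeff-∷-· j c [] g k) (+-identityʳ _)

  coeff-·-mono : ∀ j c f k → coeff (f ·ᴸ ((j , c) ∷ [])) k ≈ c * coeff f (k ℤ.- j)
  coeff-·-mono j c []            k = sym (zeroʳ c)
  coeff-·-mono j c ((i , d) ∷ f) k = begin
    (if does (i ℤ.+ j ℤ.≟ k) then d * c else 0#) + coeff (f ·ᴸ ((j , c) ∷ [])) k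
      ≡⟨ ≡.cong (λ b → (if b then d * c else 0#) + _)
           (≡.trans (≡.cong (λ s → does (s ℤ.≟ k)) (ℤ.+-comm i j)) (shift-≟ j i k)) ⟩
    (if does (i ℤ.≟ k ℤ.- j) then d * c else 0#) + coeff (f ·ᴸ ((j , c) ∷ [])) k
      ≈⟨ +-cong (if-comm _) (coeff-·-mono j c f k) ⟩
    c * (if does (i ℤ.≟ k ℤ.- j) then d else 0#) + c * coeff f (k ℤ.- j)
      ≈⟨ distribˡ c _ _ ⟨
    c * coeff ((i , d) ∷ f) (k ℤ.- j) ∎
    where
    if-comm : ∀ b → (if b then d * c else 0#) ≈ c * (if b then d else 0#)
    if-comm true  = *-comm d c
    if-comm false = sym (zeroʳ c)

  module Functional (L : Laurent → Carrier) (linear : IsLinearFunctional L) where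
    open LeftModuleMorphisms.IsLeftModuleHomomorphism linear

    -- The exponent is kept apart from the polynomial, so that a monomial factor becomes a shift of
    -- `z`.
    M : ℤ → Laurent → Carrier
    M z f = L (x^ z ·ᴸ f)

    -- `L` respects equality of coefficients, so a linear relation can be checked coefficientwise,
    -- whatever the lists of terms are.
    L-linear : ∀ f g h c → (∀ k → coeff f k ≈ c * coeff g k + coeff h k) → L f ≈ c * L g + L h
    L-linear f g h c eq = begin
      L f
        ≈⟨ ⟦⟧-cong (λ k → trans (eq k) (sym (trans (coeff-+ (c·g) h k) (+-congʳ (scale g k))))) ⟩
      L (c·g +ᴸ h)           ≈⟨ +ᴹ-homo c·g h ⟩
      L c·g + L h            ≈⟨ +-congʳ (*ₗ-homo c g) ⟩
      c * L g + L h          ∎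
      where
      c·g = map (λ (k , d) → k , c * d) g
      scale : ∀ g k → coeff (map (λ (k , d) → k , c * d) g) k ≈ c * coeff g k
      scale []            k = sym (zeroʳ c)
      scale ((j , d) ∷ g) k = trans (+-cong (if-* (does (j ℤ.≟ k)) c d) (scale g k)) (sym (distribˡ c _ _))

    coeff-x^ : ∀ z f k → coeff (x^ z ·ᴸ f) k ≈ coeff f (k ℤ.- z)
    coeff-x^ z f k = trans (coeff-mono-· z 1# f k) (*-identityˡ _)

    M-cong : ∀ z {f g} → f ≋ g → M z f ≈ M z g
    M-cong z {f} {g} f≋g = ⟦⟧-cong λ k → trans (coeff-x^ z f k) (trans (f≋g _) (sym (coeff-x^ z g k)))

    M-0 : ∀ z → M z 0ᴸ ≈ 0#
    M-0 z = 0ᴹ-homo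

    M-+ : ∀ z f g → M z (f +ᴸ g) ≈ M z f + M z g
    M-+ z f g = trans (⟦⟧-cong λ k → trans (coeff-x^ z (f +ᴸ g) k) (trans (coeff-+ f g _)
        (sym (trans (coeff-+ (x^ z ·ᴸ f) _ k) (+-cong (coeff-x^ z f k) (coeff-x^ z g k))))))
      (+ᴹ-homo _ _)

    M-neg : ∀ z f → M z (-ᴸ f) ≈ - M z f
    M-neg z f = trans (⟦⟧-cong λ k → trans (coeff-x^ z (-ᴸ f) k) (trans (coeff-neg f _)
        (sym (trans (coeff-neg (x^ z ·ᴸ f) k) (-‿cong (coeff-x^ z f k))))))
      (-ᴹ-homo _)

    M-∷ : ∀ z j c f g → M z (((j , c) ∷ f) ·ᴸ g) ≈ c * M (z ℤ.+ j) g + M z (f ·ᴸ g)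
    M-∷ z j c f g = L-linear _ _ _ c λ k → begin
      coeff (x^ z ·ᴸ (((j , c) ∷ f) ·ᴸ g)) k  ≈⟨ coeff-x^ z (((j , c) ∷ f) ·ᴸ g) k ⟩
      coeff (((j , c) ∷ f) ·ᴸ g) (k ℤ.- z)  ≈⟨ coeff-∷-· j c f g (k ℤ.- z) ⟩
      c * coeff g (k ℤ.- z ℤ.- j) + coeff (f ·ᴸ g) (k ℤ.- z)
        ≡⟨ ≡.cong (λ s → c * coeff g s + coeff (f ·ᴸ g) (k ℤ.- z)) (lemma k z j) ⟩
      c * coeff g (k ℤ.- (z ℤ.+ j)) + coeff (f ·ᴸ g) (k ℤ.- z)
        ≈⟨ +-cong (*-congˡ (coeff-x^ (z ℤ.+ j) g k)) (coeff-x^ z (f ·ᴸ g) k) ⟨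
      c * coeff (x^ (z ℤ.+ j) ·ᴸ g) k + coeff (x^ z ·ᴸ (f ·ᴸ g)) k ∎
      where
      lemma : ∀ k z j → (k ℤ.+ ℤ.- z) ℤ.+ ℤ.- j ≡ k ℤ.+ ℤ.- (z ℤ.+ j)
      lemma = solve-∀

    M-mono : ∀ z j c g → M z (((j , c) ∷ []) ·ᴸ g) ≈ c * M (z ℤ.+ j) g
    M-mono z j c g = trans (M-∷ z j c [] g) (trans (+-congˡ (M-0 z)) (+-identityʳ _))

    -- `upTo` is `applyUpTo` of the identity; the induction replaces `s` by `s ∘ suc`, which
    -- requires a general `s`.
    M-∑ : ∀ z (s : ℕ → ℕ) n g → M z (∑ᴸ (map suc (applyUpTo s n)) g) ≈ sum {n} (λ i → M z (g (suc (s (toℕ i)))))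
    M-∑ z s ℕ.zero  g = M-0 z
    M-∑ z s (suc n) g = trans (M-+ z (g (suc (s 0))) _) (+-congˡ (M-∑ z (s ∘ suc) n g))

    -- Orthogonality has the monomial on the right, `M` has it on the left; the two products agree
    -- in all coefficients.
    L-·-x^ : ∀ f z → L (f ·ᴸ x^ z) ≈ M z f
    L-·-x^ f z = ⟦⟧-cong λ k → trans (coeff-·-mono z 1# f k) (sym (coeff-mono-· z 1# f k))

    M-x^ : ∀ z k → M z (x^ k) ≈ L (x^ (z ℤ.+ k))
    M-x^ z k = ⟦⟧-cong λ i → +-congʳ (lemma (does (z ℤ.+ k ℤ.≟ i)))
      where
      lemma : ∀ b → (if b then 1# * 1# else 0#) ≈ (if b then 1# else 0#)
      lemma true  = *-identityˡ 1#
      lemma false = refl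

-- Splitting finite sums at their last terms.

module Sums {c r₁ r₂} (K : HeytingField c r₁ r₂) where
  open HeytingField K hiding (zero)
  open HeytingCommutativeRing heytingCommutativeRing using (commutativeRing)
  open CommutativeRing commutativeRing using (semiring)
  open SemiringSum semiring

  sum-zero : ∀ {n} {f : Fin n → Carrier} → (∀ i → f i ≈ 0#) → sum f ≈ 0#
  sum-zero {n} f≈0 = trans (sum-cong-≋ f≈0) (sum-replicate-zero n)

  -- The hypotheses speak of `toℕ j`, not of `inject₁` and `fromℕ`, because step vectors and weights
  -- branch on `toℕ j`.
  sum-suc : ∀ n (f : Fin (suc n) → Carrier) (g : ℕ → Carrier) {y} →
    (∀ j → toℕ j ℕ.< n → f j ≈ g (toℕ j)) → (∀ j → toℕ j ≡ n → f j ≈ y) →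
    sum f ≈ sum {n} (λ i → g (toℕ i)) + y
  sum-suc n f g init last = trans (sum-init-last f) (+-cong
    (sum-cong-≋ {n} λ i → trans
      (init (inject₁ i) (≡.subst (ℕ._< n) (≡.sym (Fin.toℕ-inject₁ i)) (Fin.toℕ<n i)))
      (reflexive (≡.cong g (Fin.toℕ-inject₁ i))))
    (last (fromℕ n) (Fin.toℕ-fromℕ n)))

  sum-suc-suc : ∀ n (f : Fin (suc (suc n)) → Carrier) (g : ℕ → Carrier) {x y} →
    (∀ j → toℕ j ℕ.< n → f j ≈ g (toℕ j)) → (∀ j → toℕ j ≡ n → f j ≈ x) → (∀ j → toℕ j ≡ suc n → f j ≈ y) →
    sum f ≈ (sum {n} (λ i → g (toℕ i)) + x) + y
  sum-suc-suc n f g init last₁ last = trans (sum-init-last f) (+-cong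
    (sum-suc n (λ i → f (inject₁ i)) g
      (λ j j<n → trans (init (inject₁ j) (≡.subst (ℕ._< n) (≡.sym (Fin.toℕ-inject₁ j)) j<n))
        (reflexive (≡.cong g (Fin.toℕ-inject₁ j))))
      (λ j j≡n → last₁ (inject₁ j) (≡.trans (Fin.toℕ-inject₁ j) j≡n)))
    (last (fromℕ (suc n)) (Fin.toℕ-fromℕ (suc n))))

  *-swap : ∀ x y z → x * (y * z) ≈ y * (x * z)
  *-swap x y z = trans (sym (*-assoc x y z)) (trans (*-congʳ (*-comm x y)) (*-assoc y x z))

-- The recurrence and orthogonality in terms of the functional.

module Moments {c r₁ r₂} (K : HeytingField c r₁ r₂)
  (ℓ : ℕ) .{{_ : NonZero ℓ}} (a : ℕ → ℕ → HeytingField.Carrier K) (P : ℤ → OverField.Laurent K)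
  (solution : OverField.IsRecurrenceSolution K ℓ a P)
  (L : OverField.Laurent K → HeytingField.Carrier K) (linear : OverField.IsLinearFunctional K L)
  (lbp : OverField.IsLBP K ℓ (λ n → P (+ n)) L)
  (L1≈1 : HeytingField._≈_ K (L (OverField.const K (HeytingField.1# K))) (HeytingField.1# K)) where

  open HeytingField K
  open OverField K

  open HeytingCommutativeRing heytingCommutativeRing using (commutativeRing)
  open CommutativeRing commutativeRing using (semiring; ring; +-commutativeMonoid)
  open SemiringSum semiring using (sum; sum-cong-≋)
  open RingProperties ring using (-‿distribˡ-*)
  open import Relation.Binary.Reasoning.Setoid setoid
  open IsRecurrenceSolution solution
  open IsLBP lbp using (h; orthogonal)
  open Sums K
  open LaurentAlgebra K
  open Functional L linear

  -- Shaped like `schröderWeight`, so that the two agree definitionally at height `+ t`.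
  α : ℕ → ℕ → Carrier
  α i t = if i ℕ.≡ᵇ 0 then 1# else a i t

  Φ : ℤ → ℕ → Carrier
  Φ z t = M z (P (+ t))

  -- This is Φ at `t - 1`. The value 0 at `t = 0` comes from `P₋₁` and mirrors the ban on descending
  -- from the x-axis.
  Ψ : ℤ → ℕ → Carrier
  Ψ z ℕ.zero    = 0#
  Ψ z (suc t) = Φ z t

  Ψ-P : ∀ z t → M z (P (+ t ℤ.- 1ℤ)) ≈ Ψ z t
  Ψ-P z ℕ.zero    = trans (M-cong z P₋₁) (M-0 z)
  Ψ-P z (suc t) = reflexive ≡.refl

  -- Solves the recurrence for the `x^ℓ P` term `Y`. The solver knows only addition, so negatives
  -- enter as separate atoms and are cancelled afterwards.
  isolate : ∀ {X Y S A B} → X ≈ (- S + (Y + - A)) + - B → Y ≈ (X + (S + A)) + B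
  isolate {X} {Y} {S} {A} {B} eq = sym (begin
    (X + (S + A)) + B                                ≈⟨ +-congʳ (+-congʳ eq) ⟩
    (((- S + (Y + - A)) + - B) + (S + A)) + B
      ≈⟨ CMS.solve 7 (λ y s s′ a a′ b b′ →
           ((((s′ ⊕ᴹ (y ⊕ᴹ a′)) ⊕ᴹ b′) ⊕ᴹ (s ⊕ᴹ a)) ⊕ᴹ b) CMS.⊜
           (y ⊕ᴹ ((s ⊕ᴹ s′) ⊕ᴹ ((a ⊕ᴹ a′) ⊕ᴹ (b ⊕ᴹ b′))))) refl Y S (- S) A (- A) B (- B) ⟩
    Y + ((S + - S) + ((A + - A) + (B + - B)))
      ≈⟨ +-congˡ (+-cong (-‿inverseʳ S) (+-cong (-‿inverseʳ A) (-‿inverseʳ B))) ⟩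
    Y + (0# + (0# + 0#))                             ≈⟨ +-congˡ (trans (+-identityˡ _) (+-identityˡ _)) ⟩
    Y + 0#                                           ≈⟨ +-identityʳ Y ⟩
    Y                                                ∎)
    where
    module CMS = CommutativeMonoidSolver +-commutativeMonoid
    open CMS using () renaming (_⊕_ to _⊕ᴹ_)

  sum-pred : ∀ n .{{_ : NonZero n}} (g : ℕ → Carrier) →
    sum {n} (λ i → g (toℕ i)) ≈ sum {n ℕ.∸ 1} (λ i → g (toℕ i)) + g (n ℕ.∸ 1)
  sum-pred (suc n) g = sum-suc n _ g (λ _ _ → refl) (λ _ j≡n → reflexive (≡.cong g j≡n))

  -- The recurrence for index `m + ℓ`, times x^z and solved for x^ℓ P_m. The term i = 0 is P_{m+ℓ}
  -- itself; the term i = ℓ comes from the constant in `x^ℓ - a_ℓ`.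
  Φ-recurrence : ∀ z m → Φ (z ℤ.+ + ℓ) m ≈
    sum {suc ℓ} (λ i → α (toℕ i) m * Φ z (m ℕ.+ (ℓ ℕ.∸ toℕ i))) + a (suc ℓ) m * Ψ (z ℤ.+ + ℓ) m
  Φ-recurrence z m = trans (isolate recurrence) (+-congʳ (sym (+-cong (*-identityˡ _)
    (trans (sum-pred ℓ λ i → a (suc i) m * Φ z (m ℕ.+ (ℓ ℕ.∸ suc i)))
      (+-congˡ (reflexive (≡.trans
        (≡.cong (λ i → a i m * Φ z (m ℕ.+ (ℓ ℕ.∸ i))) (ℕ.suc-pred ℓ))
        (≡.cong (λ d → a ℓ m * Φ z d) (≡.trans (≡.cong (m ℕ.+_) (ℕ.n∸n≡0 ℓ)) (ℕ.+-identityʳ m))))))))))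
    where
    n = m ℕ.+ ℓ

    n∸ℓ≡m : n ℕ.∸ ℓ ≡ m
    n∸ℓ≡m = ℕ.m+n∸n≡m m ℓ

    index : ∀ i → i ℕ.≤ ℓ → + n ℤ.- + i ≡ + (m ℕ.+ (ℓ ℕ.∸ i))
    index i i≤ℓ = ≡.trans (ℤ.m-n≡m⊖n n i) (≡.trans (ℤ.⊖-≥ (ℕ.≤-trans i≤ℓ (ℕ.m≤n+m ℓ m)))
      (≡.cong +_ (ℕ.+-∸-assoc m i≤ℓ)))

    indexℓ : + n ℤ.- + ℓ ≡ + m
    indexℓ = ≡.trans (index ℓ ℕ.≤-refl) (≡.cong +_ (≡.trans (≡.cong (m ℕ.+_) (ℕ.n∸n≡0 ℓ)) (ℕ.+-identityʳ m)))

    S = ∑ᴸ (map suc (upTo (ℓ ℕ.∸ 1))) (λ i → const (a i (n ℕ.∸ ℓ)) ·ᴸ P (+ n ℤ.- + i))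
    R = (x^ (+ ℓ) -ᴸ const (a ℓ (n ℕ.∸ ℓ))) ·ᴸ P (+ n ℤ.- + ℓ)
    Q = const (a (suc ℓ) (n ℕ.∸ ℓ)) ·ᴸ x^ (+ ℓ) ·ᴸ P (+ n ℤ.- + ℓ ℤ.- 1ℤ)

    S-value : M z S ≈ sum {ℓ ℕ.∸ 1} (λ i → a (suc (toℕ i)) m * Φ z (m ℕ.+ (ℓ ℕ.∸ suc (toℕ i))))
    S-value = trans (M-∑ z (λ i → i) (ℓ ℕ.∸ 1) _) (sum-cong-≋ {ℓ ℕ.∸ 1} λ i → trans (M-mono z 0ℤ _ _)
      (reflexive (≡.cong₂ _*_ (≡.cong (a _) n∸ℓ≡m)
        (≡.cong₂ (λ z k → M z (P k)) (ℤ.+-identityʳ z) (index (suc (toℕ i))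
          (≡.subst (suc (toℕ i) ℕ.≤_) (ℕ.suc-pred ℓ) (ℕ.s≤s (ℕ.<⇒≤ (Fin.toℕ<n i)))))))))

    R-value : M z R ≈ Φ (z ℤ.+ + ℓ) m + - (a ℓ m * Φ z m)
    R-value = begin
      M z R
        ≈⟨ trans (M-∷ z (+ ℓ) 1# (-ᴸ const (a ℓ (n ℕ.∸ ℓ))) p) (+-cong (*-identityˡ _) (M-mono z 0ℤ (- a ℓ (n ℕ.∸ ℓ)) p)) ⟩
      M (z ℤ.+ + ℓ) p + - a ℓ (n ℕ.∸ ℓ) * M (z ℤ.+ 0ℤ) p
        ≡⟨ ≡.cong₂ _+_ (≡.cong (λ k → M (z ℤ.+ + ℓ) (P k)) indexℓ)
             (≡.cong₂ _*_ (≡.cong (λ k → - a ℓ k) n∸ℓ≡m)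
               (≡.cong₂ (λ z k → M z (P k)) (ℤ.+-identityʳ z) indexℓ)) ⟩
      Φ (z ℤ.+ + ℓ) m + - a ℓ m * Φ z m
        ≈⟨ +-congˡ (-‿distribˡ-* _ _) ⟨
      Φ (z ℤ.+ + ℓ) m + - (a ℓ m * Φ z m) ∎
      where p = P (+ n ℤ.- + ℓ)

    Q-value : M z Q ≈ a (suc ℓ) m * Ψ (z ℤ.+ + ℓ) m
    Q-value = begin
      M z Q
        ≈⟨ M-mono z (0ℤ ℤ.+ + ℓ) (a (suc ℓ) (n ℕ.∸ ℓ) * 1#) _ ⟩
      a (suc ℓ) (n ℕ.∸ ℓ) * 1# * M (z ℤ.+ + ℓ) (P (+ n ℤ.- + ℓ ℤ.- 1ℤ))
        ≡⟨ ≡.cong₂ (λ j k → a (suc ℓ) j * 1# * M (z ℤ.+ + ℓ) (P (k ℤ.- 1ℤ))) n∸ℓ≡m indexℓ ⟩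
      a (suc ℓ) m * 1# * M (z ℤ.+ + ℓ) (P (+ m ℤ.- 1ℤ))
        ≈⟨ *-cong (*-identityʳ _) (Ψ-P _ m) ⟩
      a (suc ℓ) m * Ψ (z ℤ.+ + ℓ) m ∎

    recurrence : Φ z n ≈ (- sum {ℓ ℕ.∸ 1} (λ i → a (suc (toℕ i)) m * Φ z (m ℕ.+ (ℓ ℕ.∸ suc (toℕ i))))
      + (Φ (z ℤ.+ + ℓ) m + - (a ℓ m * Φ z m))) + - (a (suc ℓ) m * Ψ (z ℤ.+ + ℓ) m)
    recurrence = begin
      Φ z n                             ≈⟨ M-cong z (recur n (ℕ.m≤n+m ℓ m)) ⟩
      M z (-ᴸ S +ᴸ R -ᴸ Q)              ≈⟨ M-+ z (-ᴸ S +ᴸ R) (-ᴸ Q) ⟩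
      M z (-ᴸ S +ᴸ R) + M z (-ᴸ Q)      ≈⟨ +-cong (M-+ z (-ᴸ S) R) (M-neg z Q) ⟩
      M z (-ᴸ S) + M z R + - M z Q      ≈⟨ +-cong (+-cong (trans (M-neg z S) (-‿cong S-value)) R-value) (-‿cong Q-value) ⟩
      _                                 ∎

  Φ-orthogonal : ∀ k t → k ℕ.≤ t → Φ (ℤ.- + (k ℕ.* ℓ)) t ≈ h t * δ t k
  Φ-orthogonal k t k≤t = trans (sym (L-·-x^ _ _)) (orthogonal t k k≤t)

  -- Orthogonality off the diagonal. With k = 0 it settles the exponents 1 to ℓ - 1 and starts the
  -- Schröder induction; for general k it is the boundary of the dual induction.
  Φ-vanishes : ∀ k t → k ℕ.< t → Φ (ℤ.- + (k ℕ.* ℓ)) t ≈ 0#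
  Φ-vanishes k t k<t = trans (Φ-orthogonal k t (ℕ.<⇒≤ k<t)) (trans (*-congˡ δ≈0) (zeroʳ _))
    where
    δ≈0 : δ t k ≈ 0#
    δ≈0 with t ℕ.≡ᵇ k in t≡ᵇk
    ... | true  = ⊥-elim (ℕ.<⇒≢ k<t (≡.sym (ℕ.≡ᵇ⇒≡ t k (≡.subst T (≡.sym t≡ᵇk) tt))))
    ... | false = refl

  -- For `t < ℓ` the polynomial P_t is x^t, so division of an exponent by ℓ turns every moment into
  -- a value of Φ.
  Φ-moment : ∀ z t → t ℕ.< ℓ → Φ z t ≈ L (x^ (z ℤ.+ + t))
  Φ-moment z t t<ℓ = trans (M-cong z (initial t t<ℓ)) (M-x^ z (+ t))

  Φ-0-0 : Φ 0ℤ 0 ≈ 1#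
  Φ-0-0 = trans (Φ-moment 0ℤ 0 (ℕ.>-nonZero⁻¹ ℓ)) L1≈1

-- Step vectors of the two path families.

if-T : ∀ {a} {A : Set a} {b} {x y : A} → T b → (if b then x else y) ≡ x
if-T {b = true} _ = ≡.refl

if-¬T : ∀ {a} {A : Set a} {b} {x y : A} → ¬ T b → (if b then x else y) ≡ y
if-¬T {b = false} _ = ≡.refl
if-¬T {b = true}  ¬t = ⊥-elim (¬t _)

module Steps (ℓ : ℕ) where

  +-∸ : ∀ {i} → i ℕ.≤ ℓ → + ℓ ℤ.- + i ≡ + (ℓ ℕ.∸ i)
  +-∸ {i} i≤ℓ = ≡.trans (ℤ.m-n≡m⊖n ℓ i) (ℤ.⊖-≥ i≤ℓ)

  schröder-up : ∀ j → toℕ j ℕ.< suc ℓ → schröderStep ℓ j ≡ (+ toℕ j , + ℓ ℤ.- + toℕ j)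
  schröder-up j j≤ℓ = if-T (ℕ.≤⇒≤ᵇ (ℕ.≤-pred j≤ℓ))

  schröder-down : ∀ j → toℕ j ≡ suc ℓ → schröderStep ℓ j ≡ (1ℤ , -1ℤ)
  schröder-down j j≡ = if-¬T (ℕ.<⇒≱ (ℕ.≤-reflexive (≡.sym j≡)) ∘ ℕ.≤ᵇ⇒≤ (toℕ j) ℓ)

  dual-up : ∀ j → toℕ j ℕ.< ℓ → dualSchröderStep ℓ j ≡ (+ ℓ ℤ.- + toℕ j , + ℓ ℤ.- + toℕ j)
  dual-up j j<ℓ = if-T (ℕ.<⇒<ᵇ j<ℓ)

  dual-flat : ∀ j → toℕ j ≡ ℓ → dualSchröderStep ℓ j ≡ (+ ℓ , 0ℤ)
  dual-flat j j≡ℓ = ≡.trans (if-¬T (ℕ.≤⇒≯ (ℕ.≤-reflexive (≡.sym j≡ℓ)) ∘ ℕ.<ᵇ⇒< (toℕ j) ℓ))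
                            (if-T (ℕ.≡⇒≡ᵇ (toℕ j) ℓ j≡ℓ))

  dual-down : ∀ j → toℕ j ≡ suc ℓ → dualSchröderStep ℓ j ≡ (+ ℓ ℤ.- 1ℤ , -1ℤ)
  dual-down j j≡ = ≡.trans (if-¬T (ℕ.<⇒≯ (ℕ.≤-reflexive (≡.sym j≡)) ∘ ℕ.<ᵇ⇒< (toℕ j) ℓ))
                           (if-¬T (ℕ.<⇒≢ (ℕ.≤-reflexive (≡.sym j≡)) ∘ ≡.sym ∘ ℕ.≡ᵇ⇒≡ (toℕ j) ℓ))

  schröder-steps : ∀ {q} (Q : Point → Set q) → (∀ i → i ℕ.≤ ℓ → Q (+ i , + ℓ ℤ.- + i)) → Q (1ℤ , -1ℤ) →
                   ∀ j → Q (schröderStep ℓ j)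
  schröder-steps Q up down j with ℕ.m≤n⇒m<n∨m≡n (ℕ.≤-pred (Fin.toℕ<n j))
  ... | inj₁ j≤ℓ  = ≡.subst Q (≡.sym (schröder-up j j≤ℓ)) (up (toℕ j) (ℕ.≤-pred j≤ℓ))
  ... | inj₂ j≡ℓ+1 = ≡.subst Q (≡.sym (schröder-down j j≡ℓ+1)) down

  dual-steps : ∀ {q} (Q : Point → Set q) → (∀ i → i ℕ.< ℓ → Q (+ ℓ ℤ.- + i , + ℓ ℤ.- + i)) → Q (+ ℓ , 0ℤ) →
               Q (+ ℓ ℤ.- 1ℤ , -1ℤ) → ∀ j → Q (dualSchröderStep ℓ j)
  dual-steps Q up flat down j with ℕ.m≤n⇒m<n∨m≡n (ℕ.≤-pred (Fin.toℕ<n j))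
  ... | inj₂ j≡ℓ+1 = ≡.subst Q (≡.sym (dual-down j j≡ℓ+1)) down
  ... | inj₁ j≤ℓ with ℕ.m≤n⇒m<n∨m≡n (ℕ.≤-pred j≤ℓ)
  ...   | inj₁ j<ℓ = ≡.subst Q (≡.sym (dual-up j j<ℓ)) (up (toℕ j) j<ℓ)
  ...   | inj₂ j≡ℓ = ≡.subst Q (≡.sym (dual-flat j j≡ℓ)) flat

  -- Every step other than the descent raises x + y by exactly ℓ; the descent leaves it fixed.
  schröder-mono : ∀ j → 0ℤ ℤ.≤ form 1ℤ 1ℤ (schröderStep ℓ j)
  schröder-mono = schröder-steps (λ p → 0ℤ ℤ.≤ form 1ℤ 1ℤ p)
    (λ i i≤ℓ → ≡.subst (0ℤ ℤ.≤_) (lemma (+ i) (+ ℓ)) (ℤ.+≤+ ℕ.z≤n)) ℤ.≤-refl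
    where
    lemma : ∀ i ℓ → ℓ ≡ 1ℤ ℤ.* i ℤ.+ 1ℤ ℤ.* (ℓ ℤ.+ ℤ.- i)
    lemma = solve-∀

  -- The coefficient ℓ - 1 makes the form constant along the descent. The step A_i with i < ℓ raises
  -- it by ℓ (ℓ - i), the flat step by ℓ.
  dual-mono : ∀ j → 0ℤ ℤ.≤ form 1ℤ (+ ℓ ℤ.- 1ℤ) (dualSchröderStep ℓ j)
  dual-mono = dual-steps (λ p → 0ℤ ℤ.≤ form 1ℤ (+ ℓ ℤ.- 1ℤ) p)
    (λ i i<ℓ → ≡.subst (0ℤ ℤ.≤_) (≡.trans (ℤ.pos-* ℓ (ℓ ℕ.∸ i)) (≡.trans (≡.cong (+ ℓ ℤ.*_) (≡.sym (+-∸ (ℕ.<⇒≤ i<ℓ))))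
       (up (+ i) (+ ℓ)))) (ℤ.+≤+ ℕ.z≤n))
    (≡.subst (0ℤ ℤ.≤_) (flat (+ ℓ)) (ℤ.+≤+ ℕ.z≤n))
    (≡.subst (0ℤ ℤ.≤_) (down (+ ℓ)) ℤ.≤-refl)
    where
    up : ∀ i ℓ → ℓ ℤ.* (ℓ ℤ.+ ℤ.- i) ≡ 1ℤ ℤ.* (ℓ ℤ.+ ℤ.- i) ℤ.+ (ℓ ℤ.+ ℤ.- 1ℤ) ℤ.* (ℓ ℤ.+ ℤ.- i)
    up = solve-∀
    flat : ∀ ℓ → ℓ ≡ 1ℤ ℤ.* ℓ ℤ.+ (ℓ ℤ.+ ℤ.- 1ℤ) ℤ.* 0ℤ
    flat = solve-∀
    down : ∀ ℓ → 0ℤ ≡ 1ℤ ℤ.* (ℓ ℤ.+ ℤ.- 1ℤ) ℤ.+ (ℓ ℤ.+ ℤ.- 1ℤ) ℤ.* -1ℤ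
    down = solve-∀

  module _ .{{_ : NonZero ℓ}} where
    1≤ℓ : 1ℤ ℤ.≤ + ℓ
    1≤ℓ = ℤ.+≤+ (ℕ.>-nonZero⁻¹ ℓ)

    schröder-increase : ∀ j → 1ℤ ℤ.≤ form (+ 2) 1ℤ (schröderStep ℓ j)
    schröder-increase = schröder-steps (λ p → 1ℤ ℤ.≤ form (+ 2) 1ℤ p)
      (λ i i≤ℓ → ≡.subst (1ℤ ℤ.≤_) (lemma (+ i) (+ ℓ)) (ℤ.+-mono-≤ (ℤ.+≤+ (ℕ.z≤n {i})) 1≤ℓ)) ℤ.≤-refl
      where
      lemma : ∀ i ℓ → i ℤ.+ ℓ ≡ (+ 2) ℤ.* i ℤ.+ 1ℤ ℤ.* (ℓ ℤ.+ ℤ.- i)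
      lemma = solve-∀

    dual-increase : ∀ j → 1ℤ ℤ.≤ form (+ 2) -1ℤ (dualSchröderStep ℓ j)
    dual-increase = dual-steps (λ p → 1ℤ ℤ.≤ form (+ 2) -1ℤ p)
      (λ i i<ℓ → ≡.subst (1ℤ ℤ.≤_) (≡.trans (≡.sym (+-∸ (ℕ.<⇒≤ i<ℓ))) (up (+ i) (+ ℓ))) (ℤ.+≤+ (ℕ.m<n⇒0<n∸m i<ℓ)))
      (≡.subst (1ℤ ℤ.≤_) (flat (+ ℓ)) (ℤ.+-mono-≤ 1≤ℓ (ℤ.+≤+ (ℕ.z≤n {ℓ}))))
      (≡.subst (1ℤ ℤ.≤_) (down (+ ℓ)) (ℤ.+-monoˡ-≤ -1ℤ (ℤ.+-mono-≤ 1≤ℓ 1≤ℓ)))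
      where
      up : ∀ i ℓ → ℓ ℤ.+ ℤ.- i ≡ (+ 2) ℤ.* (ℓ ℤ.+ ℤ.- i) ℤ.+ -1ℤ ℤ.* (ℓ ℤ.+ ℤ.- i)
      up = solve-∀
      flat : ∀ ℓ → ℓ ℤ.+ ℓ ≡ (+ 2) ℤ.* ℓ ℤ.+ -1ℤ ℤ.* 0ℤ
      flat = solve-∀
      down : ∀ ℓ → (ℓ ℤ.+ ℓ) ℤ.+ -1ℤ ≡ (+ 2) ℤ.* (ℓ ℤ.+ ℤ.- 1ℤ) ℤ.+ -1ℤ ℤ.* -1ℤ
      down = solve-∀

    -- Arbitrary endpoints are required, since removing a first step moves the start away from that
    -- of `𝓑 n`.
    schröder-enumeration : ∀ p q → Enumeration (LatticePaths.Between (schröderStep ℓ) p q)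
    schröder-enumeration = LatticePaths.Finiteness.enumeration (schröderStep ℓ) (+ 2) 1ℤ schröder-increase

    dual-enumeration : ∀ p q → Enumeration (LatticePaths.Between (dualSchröderStep ℓ) p q)
    dual-enumeration = LatticePaths.Finiteness.enumeration (dualSchröderStep ℓ) (+ 2) -1ℤ dual-increase

-- Comparison of path sums with values of the functional.

module MomentFormulas {c r₁ r₂} (K : HeytingField c r₁ r₂)
  (ℓ : ℕ) .{{_ : NonZero ℓ}} (a : ℕ → ℕ → HeytingField.Carrier K)
  (aℓ#0 : ∀ j → HeytingField._#_ K (a ℓ j) (HeytingField.0# K)) (P : ℤ → OverField.Laurent K)
  (solution : OverField.IsRecurrenceSolution K ℓ a P)
  (L : OverField.Laurent K → HeytingField.Carrier K) (linear : OverField.IsLinearFunctional K L)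
  (lbp : OverField.IsLBP K ℓ (λ n → P (+ n)) L)
  (L1≈1 : HeytingField._≈_ K (L (OverField.const K (HeytingField.1# K))) (HeytingField.1# K)) where

  open HeytingField K
  open OverField K

  open HeytingCommutativeRing heytingCommutativeRing using (commutativeRing)
  open CommutativeRing commutativeRing using (semiring; ring; +-commutativeMonoid; *-commutativeMonoid)
  open SemiringSum semiring using (sum; sum-cong-≋; *-distribˡ-sum)
  open RingProperties ring using (-1*x≈-x; -‿involutive)
  open SemiringExp semiring using (^-homo-*)
  open import Relation.Binary.Reasoning.Setoid setoid
  open Steps ℓ
  open Sums K
  open Moments K ℓ a P solution L linear lbp L1≈1
  open Weights ℓ a aℓ#0

  α-pos : ∀ {i} t → i ≢ 0 → α i t ≡ a i t
  α-pos {ℕ.zero} t i≢0 = ⊥-elim (i≢0 ≡.refl)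
  α-pos {suc i}  t i≢0 = ≡.refl

  αℓ : ∀ t → α ℓ t ≡ a ℓ t
  αℓ t = α-pos t (ℕ.≢-nonZero⁻¹ ℓ)

  term : (ℕ → Carrier) → ℕ → ℕ → Carrier
  term F t i = α i t * F (t ℕ.+ (ℓ ℕ.∸ i))

  -- The non-descending part of the recurrence, horizontal step i = ℓ included. It acts on values of
  -- Φ and on path sums alike.
  up : (ℕ → Carrier) → ℕ → Carrier
  up F t = sum {suc ℓ} (λ i → term F t (toℕ i))

  up-zero : ∀ {F} t → (∀ s → F s ≈ 0#) → up F t ≈ 0#
  up-zero {F} t F≈0 = sum-zero {suc ℓ} λ i → trans (*-congˡ {α (toℕ i) t} (F≈0 (t ℕ.+ (ℓ ℕ.∸ toℕ i)))) (zeroʳ _)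

  up-scale : ∀ {F G} c t → (∀ s → F s ≈ c * G s) → up F t ≈ c * up G t
  up-scale {F} {G} c t F≈cG = trans
    (sum-cong-≋ {suc ℓ} λ i → trans (*-congˡ {α (toℕ i) t} (F≈cG (t ℕ.+ (ℓ ℕ.∸ toℕ i)))) (*-swap _ c _))
    (sym (*-distribˡ-sum {suc ℓ} c (λ i → term G t (toℕ i))))

  up-split : ∀ F t → up F t ≈ sum {ℓ} (λ i → term F t (toℕ i)) + a ℓ t * F t
  up-split F t = sum-suc ℓ _ (term F t) (λ _ _ → refl)
    (λ j j≡ℓ → reflexive (≡.cong₂ _*_ (≡.trans (≡.cong (λ i → α i t) j≡ℓ) (αℓ t))
      (≡.cong F (≡.trans (≡.cong (t ℕ.+_) (≡.trans (≡.cong (ℓ ℕ.∸_) j≡ℓ) (ℕ.n∸n≡0 ℓ))) (ℕ.+-identityʳ t)))))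

  -- Schröder paths and the exponents from ℓ on.

  module Positive (n : ℕ) where
    open Paths (schröderStep ℓ)
    open TotalWeight.Transfer K (schröderStep ℓ) schröderWeight schröder-enumeration

    -- Along a path x^k P_t, taken at (s , t), has s + t + k constant; at the target k = ℓ, t = 0.
    point : ℤ → ℤ → Point
    point k t = (+ n ℤ.+ + ℓ) ℤ.- k ℤ.- t , t

    pt : ℕ → ℕ → Point
    pt k t = point (+ (k ℕ.* ℓ)) (+ t)

    target : Point
    target = + n , 0ℤ

    V : ℕ → ℕ → Carrier
    V k t = W (pt k t) target

    -- Counterpart of `Ψ`: the value at 0 says that no path descends from the x-axis.
    V⁻ : ℕ → ℕ → Carrier
    V⁻ k ℕ.zero    = 0#
    V⁻ k (suc t) = V k t

    -- The form x + y equals n + ℓ at `pt 0 t` but only n at the target.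
    V-0 : ∀ t → V 0 t ≈ 0#
    V-0 t = W-empty (pt 0 t) target (¬Between-form 1ℤ 1ℤ schröder-mono (pt 0 t) target
      (≡.subst₂ ℤ._<_ (lemma₁ (+ n)) (lemma₂ (+ n) (+ ℓ) (+ t))
        (ℤ.+-monoʳ-< (+ n) (ℤ.+<+ (ℕ.>-nonZero⁻¹ ℓ)))))
      where
      lemma₁ : ∀ n → n ℤ.+ 0ℤ ≡ 1ℤ ℤ.* n ℤ.+ 1ℤ ℤ.* 0ℤ
      lemma₁ = solve-∀
      lemma₂ : ∀ n ℓ t → n ℤ.+ ℓ ≡ 1ℤ ℤ.* (((n ℤ.+ ℓ) ℤ.+ ℤ.- 0ℤ) ℤ.+ ℤ.- t) ℤ.+ 1ℤ ℤ.* t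
      lemma₂ = solve-∀

    pt-up : ∀ k t j → toℕ j ℕ.< suc ℓ → pt (suc k) t ⊕ schröderStep ℓ j ≡ pt k (t ℕ.+ (ℓ ℕ.∸ toℕ j))
    pt-up k t j j≤ℓ = ≡.trans (≡.cong (pt (suc k) t ⊕_) (schröder-up j j≤ℓ)) (≡.trans
      (≡.cong (_, + t ℤ.+ (+ ℓ ℤ.- + toℕ j)) (lemma (+ n) (+ ℓ) (+ (k ℕ.* ℓ)) (+ t) (+ toℕ j)))
      (≡.cong (λ d → point (+ (k ℕ.* ℓ)) (+ t ℤ.+ d)) (+-∸ (ℕ.≤-pred j≤ℓ))))
      where
      lemma : ∀ n ℓ k t i → (((n ℤ.+ ℓ) ℤ.+ ℤ.- (ℓ ℤ.+ k)) ℤ.+ ℤ.- t) ℤ.+ i ≡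
              ((n ℤ.+ ℓ) ℤ.+ ℤ.- k) ℤ.+ ℤ.- (t ℤ.+ (ℓ ℤ.+ ℤ.- i))
      lemma = solve-∀

    W-down : ∀ k t j → toℕ j ≡ suc ℓ → W (pt k t ⊕ schröderStep ℓ j) target ≈ V⁻ k t
    W-down k ℕ.zero j j≡ = W-empty (pt k 0 ⊕ schröderStep ℓ j) target (¬Between-below _ _ λ 0≤ →
      ℤ.<⇒≱ ℤ.-<+ (≡.subst (λ s → 0ℤ ℤ.≤ 0ℤ ℤ.+ proj₂ s) (schröder-down j j≡) 0≤))
    W-down k (suc t) j j≡ = reflexive (≡.cong (λ p → W p target)
      (≡.trans (≡.cong (pt k (suc t) ⊕_) (schröder-down j j≡))
        (≡.cong (_, + t) (lemma (+ n) (+ ℓ) (+ (k ℕ.* ℓ)) (+ t)))))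
      where
      lemma : ∀ n ℓ k t → (((n ℤ.+ ℓ) ℤ.+ ℤ.- k) ℤ.+ ℤ.- (1ℤ ℤ.+ t)) ℤ.+ 1ℤ ≡ ((n ℤ.+ ℓ) ℤ.+ ℤ.- k) ℤ.+ ℤ.- t
      lemma = solve-∀

    V-suc : ∀ k t (d : Dec (pt (suc k) t ≡ target)) →
      V (suc k) t ≈ (if does d then 1# else 0#) + (up (V k) t + a (suc ℓ) t * V⁻ (suc k) t)
    V-suc k t d = trans (W-first-step (pt (suc k) t) target (ℤ.+≤+ ℕ.z≤n) d) (+-congˡ
      (sum-suc (suc ℓ) _ (λ i → α i t * V k (t ℕ.+ (ℓ ℕ.∸ i)))
        (λ j j≤ℓ → *-congˡ (reflexive (≡.cong (λ p → W p target) (pt-up k t j j≤ℓ))))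
        (λ j j≡ → *-cong
          (reflexive (≡.trans (α-pos t λ j≡0 → ℕ.1+n≢0 (≡.trans (≡.sym j≡) j≡0)) (≡.cong (λ i → a i t) j≡)))
          (W-down (suc k) t j j≡))))

    -- For i < ℓ the index t + ℓ - i is positive, so orthogonality leaves only the term i = ℓ.
    up-Φ-0 : ∀ t → up (Φ 0ℤ) t ≈ a ℓ t * Φ 0ℤ t
    up-Φ-0 t = trans (up-split (Φ 0ℤ) t) (trans (+-congʳ (sum-zero {ℓ} vanishes)) (+-identityˡ _))
      where
      vanishes : ∀ i → term (Φ 0ℤ) t (toℕ i) ≈ 0#
      vanishes i = trans (*-congˡ (Φ-vanishes 0 _ (ℕ.<-≤-trans (ℕ.m<n⇒0<n∸m (Fin.toℕ<n i)) (ℕ.m≤n+m _ t)))) (zeroʳ _)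

    Φ-suc : ∀ k t → Φ (+ (suc k ℕ.* ℓ)) t ≈ up (Φ (+ (k ℕ.* ℓ))) t + a (suc ℓ) t * Ψ (+ (suc k ℕ.* ℓ)) t
    Φ-suc k t = ≡.subst (λ z → Φ z t ≈ up (Φ (+ (k ℕ.* ℓ))) t + a (suc ℓ) t * Ψ z t)
      (ℤ.+-comm (+ (k ℕ.* ℓ)) (+ ℓ)) (Φ-recurrence (+ (k ℕ.* ℓ)) t)

    -- Pairs the decision needed by `V-suc` with the comparison of non-descending parts, in which
    -- the same indicator accounts for the empty path.
    UpStep : ℕ → ℕ → Set _
    UpStep k t = Σ (Dec (pt (suc k) t ≡ target)) λ d →
      up (Φ (+ (k ℕ.* ℓ))) t ≈ a ℓ 0 * ((if does d then 1# else 0#) + up (V k) t)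

    upStep-0 : ∀ t → UpStep 0 t
    -- Here `pt 1 0` is the target; its empty path matches the surviving last step, of value a_{ℓ,0}
    -- Φ(0,0) = a_{ℓ,0}.
    upStep-0 ℕ.zero = yes (≡.cong (_, 0ℤ) (lemma (+ n) (+ ℓ))) , (begin
      up (Φ 0ℤ) 0               ≈⟨ up-Φ-0 0 ⟩
      a ℓ 0 * Φ 0ℤ 0            ≈⟨ *-congˡ (trans Φ-0-0 (sym (+-identityʳ 1#))) ⟩
      a ℓ 0 * (1# + 0#)         ≈⟨ *-congˡ (+-congˡ (up-zero 0 V-0)) ⟨
      a ℓ 0 * (1# + up (V 0) 0) ∎)
      where
      lemma : ∀ n ℓ → ((n ℤ.+ ℓ) ℤ.+ ℤ.- (ℓ ℤ.+ 0ℤ)) ℤ.+ ℤ.- 0ℤ ≡ n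
      lemma = solve-∀
    upStep-0 (suc t) = no (λ ()) , (begin
      up (Φ 0ℤ) (suc t)               ≈⟨ up-Φ-0 (suc t) ⟩
      a ℓ (suc t) * Φ 0ℤ (suc t)      ≈⟨ trans (*-congˡ (Φ-vanishes 0 (suc t) (ℕ.s≤s ℕ.z≤n))) (zeroʳ _) ⟩
      0#                              ≈⟨ trans (*-congˡ (+-identityʳ 0#)) (zeroʳ _) ⟨
      a ℓ 0 * (0# + 0#)               ≈⟨ *-congˡ (+-congˡ (up-zero (suc t) V-0)) ⟨
      a ℓ 0 * (0# + up (V 0) (suc t)) ∎)

    upStep-suc : ∀ k t → (∀ s → Φ (+ (suc k ℕ.* ℓ)) s ≈ a ℓ 0 * V (suc k) s) → UpStep (suc k) t
    upStep-suc k t Φ≈ = no distinct , trans (up-scale (a ℓ 0) t Φ≈) (*-congˡ (sym (+-identityˡ _)))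
      where
      positive : 0ℤ ℤ.< + n ℤ.- proj₁ (pt (suc (suc k)) t)
      -- The point lies (k + 1)ℓ + t to the left of the target.
      positive = ≡.subst (0ℤ ℤ.<_) (lemma′ (+ ℓ) (+ (k ℕ.* ℓ)) (+ t) (+ n))
        (ℤ.+<+ (ℕ.<-≤-trans (ℕ.>-nonZero⁻¹ ℓ) (ℕ.m≤m+n ℓ _)))
        where
        lemma′ : ∀ ℓ k t n → ℓ ℤ.+ (k ℤ.+ t) ≡ n ℤ.- ((n ℤ.+ ℓ) ℤ.- (ℓ ℤ.+ (ℓ ℤ.+ k)) ℤ.- t)
        lemma′ = solve-∀
      distinct : pt (suc (suc k)) t ≢ target
      distinct p≡q = ℤ.<-irrefl (≡.sym (ℤ.+-inverseʳ (+ n)))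
        (≡.subst (λ x → 0ℤ ℤ.< + n ℤ.- x) (≡.cong proj₁ p≡q) positive)

    -- Induction on `t` within one level: the descent keeps the level and lowers `t`, while all
    -- other steps lead to level `k`, covered by `step`.
    Φ≈V-from : ∀ k → (∀ t → UpStep k t) → ∀ t → Φ (+ (suc k ℕ.* ℓ)) t ≈ a ℓ 0 * V (suc k) t
    Ψ≈V⁻-from : ∀ k → (∀ t → UpStep k t) → ∀ t → Ψ (+ (suc k ℕ.* ℓ)) t ≈ a ℓ 0 * V⁻ (suc k) t
    Φ≈V-from k step t with d , eq ← step t = begin
      Φ (+ (suc k ℕ.* ℓ)) t
        ≈⟨ Φ-suc k t ⟩
      up (Φ (+ (k ℕ.* ℓ))) t + a (suc ℓ) t * Ψ (+ (suc k ℕ.* ℓ)) t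
        ≈⟨ +-cong eq (trans (*-congˡ (Ψ≈V⁻-from k step t)) (*-swap _ _ _)) ⟩
      a ℓ 0 * (b + up (V k) t) + a ℓ 0 * (a (suc ℓ) t * V⁻ (suc k) t)
        ≈⟨ distribˡ _ _ _ ⟨
      a ℓ 0 * (b + up (V k) t + a (suc ℓ) t * V⁻ (suc k) t)
        ≈⟨ *-congˡ (trans (+-assoc _ _ _) (sym (V-suc k t d))) ⟩
      a ℓ 0 * V (suc k) t ∎
      where b = if does d then 1# else 0#
    Ψ≈V⁻-from k step ℕ.zero    = sym (zeroʳ _)
    Ψ≈V⁻-from k step (suc t) = Φ≈V-from k step t

    Φ≈V : ∀ k t → Φ (+ (suc k ℕ.* ℓ)) t ≈ a ℓ 0 * V (suc k) t
    Φ≈V ℕ.zero    = Φ≈V-from 0 upStep-0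
    Φ≈V (suc k) = Φ≈V-from (suc k) λ t → upStep-suc k t (Φ≈V k)

    -- With n = kℓ + r, the monomial x^(n+ℓ) is x^((k+1)ℓ) P_r, and `pt (suc k) r` is the start (0,
    -- r) of the paths in `𝓑 n`.
    moment : L (x^ (+ n ℤ.+ + ℓ)) ≈ a ℓ 0 * w𝓑 n
    moment = begin
      L (x^ (+ n ℤ.+ + ℓ))
        ≡⟨ ≡.cong (λ i → L (x^ i)) (≡.trans (≡.cong (ℤ._+ + ℓ) division) (lemma₁ (+ r) (+ (k ℕ.* ℓ)) (+ ℓ))) ⟩
      L (x^ (+ (suc k ℕ.* ℓ) ℤ.+ + r))
        ≈⟨ Φ-moment (+ (suc k ℕ.* ℓ)) r (ℕ.m%n<n n ℓ) ⟨
      Φ (+ (suc k ℕ.* ℓ)) r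
        ≈⟨ Φ≈V k r ⟩
      a ℓ 0 * V (suc k) r
        ≡⟨ ≡.cong (λ s → a ℓ 0 * W (s , + r) target)
             (≡.trans (≡.cong (λ n → n ℤ.+ + ℓ ℤ.- + (suc k ℕ.* ℓ) ℤ.- + r) division)
               (lemma₂ (+ r) (+ (k ℕ.* ℓ)) (+ ℓ))) ⟩
      a ℓ 0 * W (0ℤ , + r) target
        ≈⟨ *-congˡ (W-totalWeight (𝓑-enum ℓ n)) ⟩
      a ℓ 0 * w𝓑 n ∎
      where
      r = n ℕ.% ℓ
      k = n ℕ./ ℓ
      division : + n ≡ + r ℤ.+ + (k ℕ.* ℓ)
      division = ≡.cong +_ (ℕ.m≡m%n+[m/n]*n n ℓ)
      lemma₁ : ∀ r k ℓ → (r ℤ.+ k) ℤ.+ ℓ ≡ (ℓ ℤ.+ k) ℤ.+ r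
      lemma₁ = solve-∀
      lemma₂ : ∀ r k ℓ → (((r ℤ.+ k) ℤ.+ ℓ) ℤ.+ ℤ.- (ℓ ℤ.+ k)) ℤ.+ ℤ.- r ≡ 0ℤ
      lemma₂ = solve-∀

  -- Signs and weights of dual steps.

  aℓ⁻¹ : ℕ → Carrier
  aℓ⁻¹ t = recip (a ℓ t) (aℓ#0 t)

  -- As `α 0 t` is 1, the weight of A_0 is the case i = 0 of the general formula; only the flat step
  -- is an exception.
  dual-weight : ∀ j s t → toℕ j ≢ ℓ →
    dualSchröderWeight j (s , + t) ≈ sgn (ℓ ℕ.+ 1 ℕ.+ toℕ j) * α (toℕ j) t * aℓ⁻¹ t
  dual-weight j s t j≢ℓ with toℕ j
  ... | ℕ.zero = *-congʳ (sym (trans (*-identityʳ _) (reflexive (≡.cong sgn (ℕ.+-identityʳ (ℓ ℕ.+ 1))))))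
  ... | suc i  = reflexive (if-¬T (j≢ℓ ∘ ℕ.≡ᵇ⇒≡ (suc i) ℓ))

  dual-weight-flat : ∀ j s t → toℕ j ≡ ℓ → dualSchröderWeight j (s , + t) ≈ aℓ⁻¹ t
  dual-weight-flat j s t j≡ℓ = reflexive (≡.trans
    (if-¬T λ j≡ᵇ0 → ℕ.≢-nonZero⁻¹ ℓ (≡.trans (≡.sym j≡ℓ) (ℕ.≡ᵇ⇒≡ (toℕ j) 0 j≡ᵇ0)))
    (if-T (ℕ.≡⇒≡ᵇ (toℕ j) ℓ j≡ℓ)))

  sgn-+ : ∀ m n → sgn (m ℕ.+ n) ≈ sgn m * sgn n
  sgn-+ = ^-homo-* (- 1#)

  -1*-1≈1 : - 1# * - 1# ≈ 1#
  -1*-1≈1 = trans (-1*x≈-x (- 1#)) (-‿involutive 1#)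

  sgn-square : ∀ m → sgn m * sgn m ≈ 1#
  sgn-square ℕ.zero  = *-identityˡ 1#
  sgn-square (suc m) = begin
    (- 1# * sgn m) * (- 1# * sgn m)  ≈⟨ *-assoc _ _ _ ⟩
    - 1# * (sgn m * (- 1# * sgn m))  ≈⟨ *-congˡ (*-swap _ _ _) ⟩
    - 1# * (- 1# * (sgn m * sgn m))  ≈⟨ *-assoc _ _ _ ⟨
    (- 1# * - 1#) * (sgn m * sgn m)  ≈⟨ *-cong -1*-1≈1 (sgn-square m) ⟩
    1# * 1#                          ≈⟨ *-identityˡ 1# ⟩
    1#                               ∎

  -- The exponent is (ℓ - i) + 2i + 1. The sign of ℓ - i, the rise of the step, is absorbed by the
  -- factor (-1)^t; a uniform -1 remains.
  sgn-up : ∀ i → i ℕ.≤ ℓ → sgn (ℓ ℕ.+ 1 ℕ.+ i) ≈ - 1# * sgn (ℓ ℕ.∸ i)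
  sgn-up i i≤ℓ = begin
    sgn (ℓ ℕ.+ 1 ℕ.+ i)             ≡⟨ ≡.cong (λ m → sgn (m ℕ.+ 1 ℕ.+ i)) (ℕ.m∸n+n≡m i≤ℓ) ⟨
    sgn (d ℕ.+ i ℕ.+ 1 ℕ.+ i)       ≈⟨ trans (sgn-+ (d ℕ.+ i ℕ.+ 1) i) (*-congʳ (trans (sgn-+ (d ℕ.+ i) 1) (*-congʳ (sgn-+ d i)))) ⟩
    sgn d * sgn i * (- 1# * 1#) * sgn i
      ≈⟨ CMS.solve 4 (λ d i m o → ((d ⊕ᴹ i) ⊕ᴹ (m ⊕ᴹ o)) ⊕ᴹ i CMS.⊜ (m ⊕ᴹ d) ⊕ᴹ (o ⊕ᴹ (i ⊕ᴹ i))) refl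
           (sgn d) (sgn i) (- 1#) 1# ⟩
    (- 1# * sgn d) * (1# * (sgn i * sgn i))  ≈⟨ *-congˡ (trans (*-identityˡ _) (sgn-square i)) ⟩
    (- 1# * sgn d) * 1#             ≈⟨ *-identityʳ _ ⟩
    - 1# * sgn d                    ∎
    where
    d = ℓ ℕ.∸ i
    module CMS = CommutativeMonoidSolver *-commutativeMonoid
    open CMS using () renaming (_⊕_ to _⊕ᴹ_)

  -- The exponent is twice ℓ + 1. The -1 at a descent comes instead from the height dropping by one.
  sgn-down : sgn (ℓ ℕ.+ 1 ℕ.+ suc ℓ) ≈ 1#
  sgn-down = trans (sgn-+ (ℓ ℕ.+ 1) (suc ℓ)) (trans
    (*-congʳ (reflexive (≡.cong sgn (ℕ.+-comm ℓ 1)))) (sgn-square (suc ℓ)))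

  -- Solves the recurrence for the term `X` with coefficient a_ℓ. The three factors are what the
  -- dual weights contribute once (-1)^t is accounted for.
  isolate-dual : ∀ t {X Y S B} → Y ≈ (S + a ℓ t * X) + B →
    ((- 1# * aℓ⁻¹ t) * S + aℓ⁻¹ t * Y) + (- 1# * aℓ⁻¹ t) * B ≈ X
  isolate-dual t {X} {Y} {S} {B} Y≈ = begin
    ((- 1# * aℓ⁻¹ t) * S + aℓ⁻¹ t * Y) + (- 1# * aℓ⁻¹ t) * B
      ≈⟨ +-cong (+-cong (neg S) (trans (*-congˡ Y≈) (trans (distribˡ _ _ _) (+-congʳ (trans (distribˡ _ _ _) (+-congˡ cancel)))))) (neg B) ⟩
    (- (aℓ⁻¹ t * S) + ((aℓ⁻¹ t * S + X) + aℓ⁻¹ t * B)) + - (aℓ⁻¹ t * B)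
      ≈⟨ CMS.solve 5 (λ s s′ x b b′ → (s′ ⊕ᴹ ((s ⊕ᴹ x) ⊕ᴹ b)) ⊕ᴹ b′ CMS.⊜ x ⊕ᴹ ((s ⊕ᴹ s′) ⊕ᴹ (b ⊕ᴹ b′))) refl
           (aℓ⁻¹ t * S) (- (aℓ⁻¹ t * S)) X (aℓ⁻¹ t * B) (- (aℓ⁻¹ t * B)) ⟩
    X + ((aℓ⁻¹ t * S + - (aℓ⁻¹ t * S)) + (aℓ⁻¹ t * B + - (aℓ⁻¹ t * B)))
      ≈⟨ +-congˡ (trans (+-cong (-‿inverseʳ _) (-‿inverseʳ _)) (+-identityˡ 0#)) ⟩
    X + 0#  ≈⟨ +-identityʳ X ⟩
    X       ∎
    where
    module CMS = CommutativeMonoidSolver +-commutativeMonoid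
    open CMS using () renaming (_⊕_ to _⊕ᴹ_)
    neg : ∀ x → (- 1# * aℓ⁻¹ t) * x ≈ - (aℓ⁻¹ t * x)
    neg x = trans (*-assoc _ _ _) (-1*x≈-x _)
    cancel : aℓ⁻¹ t * (a ℓ t * X) ≈ X
    cancel = trans (sym (*-assoc _ _ _)) (trans (*-congʳ (trans (*-comm _ _) (recip-inverseʳ _ _))) (*-identityˡ X))

  -- Dual paths and the exponents up to 0.

  module Negative (n : ℕ) where
    open Paths (dualSchröderStep ℓ)
    open TotalWeight.Transfer K (dualSchröderStep ℓ) dualSchröderWeight dual-enumeration

    -- Along a dual path x^(-k) P_t, taken at (s , t), has s - t + k constant; at the target k = t = 0.
    point : ℤ → ℤ → Point
    point k t = (+ n ℤ.- k) ℤ.+ t , t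

    pt : ℕ → ℕ → Point
    pt k t = point (+ (k ℕ.* ℓ)) (+ t)

    target : Point
    target = + n , 0ℤ

    U : ℕ → ℕ → Carrier
    U k t = W (pt k t) target

    U⁻ : ℕ → ℕ → Carrier
    U⁻ k ℕ.zero  = 0#
    U⁻ k (suc t) = U k t

    W-beyond : ∀ p → form 1ℤ (+ ℓ ℤ.- 1ℤ) target ℤ.< form 1ℤ (+ ℓ ℤ.- 1ℤ) p → W p target ≈ 0#
    W-beyond p target<p = W-empty p target (¬Between-form 1ℤ (+ ℓ ℤ.- 1ℤ) dual-mono p target target<p)

    -- At `pt k t` the form x + (ℓ - 1) y is n + (t - k)ℓ, which exceeds its target value n when t >
    -- k.
    U-vanishes : ∀ k t → k ℕ.< t → U k t ≈ 0#
    U-vanishes k t k<t = W-beyond (pt k t) (≡.subst₂ ℤ._<_ (lemma₁ (+ n) (+ ℓ) (+ (k ℕ.* ℓ)))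
      (≡.trans (≡.cong (λ x → (+ n ℤ.- + (k ℕ.* ℓ)) ℤ.+ x) (ℤ.pos-* t ℓ)) (lemma₂ (+ n) (+ ℓ) (+ (k ℕ.* ℓ)) (+ t)))
      (ℤ.+-monoʳ-< (+ n ℤ.- + (k ℕ.* ℓ)) (ℤ.+<+ (ℕ.*-monoˡ-< ℓ k<t))))
      where
      lemma₁ : ∀ n ℓ k → (n ℤ.+ ℤ.- k) ℤ.+ k ≡ 1ℤ ℤ.* n ℤ.+ (ℓ ℤ.+ ℤ.- 1ℤ) ℤ.* 0ℤ
      lemma₁ = solve-∀
      lemma₂ : ∀ n ℓ k t → (n ℤ.+ ℤ.- k) ℤ.+ t ℤ.* ℓ ≡ 1ℤ ℤ.* ((n ℤ.+ ℤ.- k) ℤ.+ t) ℤ.+ (ℓ ℤ.+ ℤ.- 1ℤ) ℤ.* t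
      lemma₂ = solve-∀

    pt-up : ∀ k t i → i ℕ.< ℓ → pt k t ⊕ (+ ℓ ℤ.- + i , + ℓ ℤ.- + i) ≡ pt k (t ℕ.+ (ℓ ℕ.∸ i))
    pt-up k t i i<ℓ = ≡.trans
      (≡.cong (_, + t ℤ.+ (+ ℓ ℤ.- + i)) (ℤ.+-assoc (+ n ℤ.- + (k ℕ.* ℓ)) (+ t) (+ ℓ ℤ.- + i)))
      (≡.cong (λ d → point (+ (k ℕ.* ℓ)) (+ t ℤ.+ d)) (+-∸ (ℕ.<⇒≤ i<ℓ)))

    pt-flat : ∀ k t → pt (suc k) t ⊕ (+ ℓ , 0ℤ) ≡ pt k t
    pt-flat k t = ≡.cong₂ _,_ (lemma (+ n) (+ ℓ) (+ (k ℕ.* ℓ)) (+ t)) (ℤ.+-identityʳ (+ t))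
      where
      lemma : ∀ n ℓ k t → ((n ℤ.+ ℤ.- (ℓ ℤ.+ k)) ℤ.+ t) ℤ.+ ℓ ≡ (n ℤ.+ ℤ.- k) ℤ.+ t
      lemma = solve-∀

    W-down : ∀ k t → W (pt (suc k) t ⊕ (+ ℓ ℤ.- 1ℤ , -1ℤ)) target ≈ U⁻ k t
    W-down k ℕ.zero  = W-empty (pt (suc k) 0 ⊕ (+ ℓ ℤ.- 1ℤ , -1ℤ)) target (¬Between-below _ target (ℤ.<⇒≱ ℤ.-<+))
    W-down k (suc t) = reflexive (≡.cong (λ x → W (x , + t) target) (lemma (+ n) (+ ℓ) (+ (k ℕ.* ℓ)) (+ t)))
      where
      lemma : ∀ n ℓ k t → ((n ℤ.+ ℤ.- (ℓ ℤ.+ k)) ℤ.+ (1ℤ ℤ.+ t)) ℤ.+ (ℓ ℤ.+ ℤ.- 1ℤ) ≡ (n ℤ.+ ℤ.- k) ℤ.+ t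
      lemma = solve-∀

    -- Only the empty path counts: an ascending or flat first step raises the monotone form above
    -- its value at the target, and a descent leaves the half-plane.
    U-0-0 : U 0 0 ≈ 1#
    U-0-0 = begin
      U 0 0     ≈⟨ W-first-step (pt 0 0) target ℤ.≤-refl (yes (≡.cong (_, 0ℤ) (lemma (+ n)))) ⟩
      1# + sum {suc (suc ℓ)} (λ j → dualSchröderWeight j (pt 0 0) * W (pt 0 0 ⊕ dualSchröderStep ℓ j) target)
        ≈⟨ +-congˡ (sum-zero {suc (suc ℓ)} λ j → trans (*-congˡ {dualSchröderWeight j (pt 0 0)} (vanishes j)) (zeroʳ _)) ⟩
      1# + 0#   ≈⟨ +-identityʳ 1# ⟩
      1#        ∎
      where
      lemma : ∀ n → (n ℤ.+ ℤ.- 0ℤ) ℤ.+ 0ℤ ≡ n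
      lemma = solve-∀
      lemma₁ : ∀ n ℓ → n ℤ.+ 0ℤ ≡ 1ℤ ℤ.* n ℤ.+ (ℓ ℤ.+ ℤ.- 1ℤ) ℤ.* 0ℤ
      lemma₁ = solve-∀
      lemma₂ : ∀ n ℓ → n ℤ.+ ℓ ≡ 1ℤ ℤ.* (((n ℤ.+ ℤ.- 0ℤ) ℤ.+ 0ℤ) ℤ.+ ℓ) ℤ.+ (ℓ ℤ.+ ℤ.- 1ℤ) ℤ.* (0ℤ ℤ.+ 0ℤ)
      lemma₂ = solve-∀
      vanishes : ∀ j → W (pt 0 0 ⊕ dualSchröderStep ℓ j) target ≈ 0#
      vanishes = dual-steps (λ s → W (pt 0 0 ⊕ s) target ≈ 0#)
        (λ i i<ℓ → trans (reflexive (≡.cong (λ p → W p target) (pt-up 0 0 i i<ℓ)))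
          (U-vanishes 0 _ (ℕ.m<n⇒0<n∸m i<ℓ)))
        (W-beyond _ (≡.subst₂ ℤ._<_ (lemma₁ (+ n) (+ ℓ)) (lemma₂ (+ n) (+ ℓ))
          (ℤ.+-monoʳ-< (+ n) (ℤ.+<+ (ℕ.>-nonZero⁻¹ ℓ)))))
        (W-empty _ target (¬Between-below _ target (ℤ.<⇒≱ ℤ.-<+)))

    dual-term : ℕ → ℕ → ℕ → Carrier
    dual-term k t i = sgn (ℓ ℕ.+ 1 ℕ.+ i) * α i t * aℓ⁻¹ t * U (suc k) (t ℕ.+ (ℓ ℕ.∸ i))

    -- Ascending steps keep the level and gain height; the flat and the descending step lower the
    -- level by one.
    U-suc : ∀ k t → U (suc k) t ≈
      (sum {ℓ} (λ i → dual-term k t (toℕ i)) + aℓ⁻¹ t * U k t) + a (suc ℓ) t * aℓ⁻¹ t * U⁻ k t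
    U-suc k t = trans (trans (W-first-step (pt (suc k) t) target (ℤ.+≤+ ℕ.z≤n) (no distinct)) (+-identityˡ _))
      (sum-suc-suc ℓ _ (dual-term k t)
        (λ j j<ℓ → *-cong (dual-weight j x t (ℕ.<⇒≢ j<ℓ))
          (reflexive (≡.cong (λ p → W p target) (≡.trans (≡.cong (pt (suc k) t ⊕_) (dual-up j j<ℓ)) (pt-up (suc k) t (toℕ j) j<ℓ)))))
        (λ j j≡ℓ → *-cong (dual-weight-flat j x t j≡ℓ)
          (reflexive (≡.cong (λ p → W p target) (≡.trans (≡.cong (pt (suc k) t ⊕_) (dual-flat j j≡ℓ)) (pt-flat k t)))))
        (λ j j≡ → *-cong (trans (dual-weight j x t λ j≡ℓ → ℕ.1+n≢n (≡.trans (≡.sym j≡) j≡ℓ)) (*-congʳ (down-weight j j≡)))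
          (trans (reflexive (≡.cong (λ p → W (pt (suc k) t ⊕ p) target) (dual-down j j≡))) (W-down k t))))
      where
      x = proj₁ (pt (suc k) t)
      down-weight : ∀ j → toℕ j ≡ suc ℓ → sgn (ℓ ℕ.+ 1 ℕ.+ toℕ j) * α (toℕ j) t ≈ a (suc ℓ) t
      down-weight j j≡ = trans (reflexive (≡.cong (λ i → sgn (ℓ ℕ.+ 1 ℕ.+ i) * α i t) j≡))
        (trans (*-congʳ sgn-down) (*-identityˡ _))
      distinct : pt (suc k) t ≢ target
      -- Equal heights force t = 0, and then the point lies (k + 1)ℓ to the left of the target.
      distinct p≡q = ℤ.<-irrefl
        (≡.trans (≡.cong (ℤ._+_ (+ n ℤ.- + (suc k ℕ.* ℓ))) (≡.sym (≡.cong proj₂ p≡q))) (≡.cong proj₁ p≡q))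
        (≡.subst (ℤ._<_ ((+ n ℤ.- + (suc k ℕ.* ℓ)) ℤ.+ 0ℤ)) (lemma (+ n) (+ ℓ) (+ (k ℕ.* ℓ)))
          (ℤ.+-monoʳ-< (+ n ℤ.- + (suc k ℕ.* ℓ))
            (ℤ.+<+ (ℕ.<-≤-trans (ℕ.>-nonZero⁻¹ ℓ) (ℕ.m≤m+n ℓ (k ℕ.* ℓ))))))
        where
        lemma : ∀ n ℓ k → (n ℤ.+ ℤ.- (ℓ ℤ.+ k)) ℤ.+ (ℓ ℤ.+ k) ≡ n
        lemma = solve-∀

    neg : ℕ → ℤ
    neg k = ℤ.- + (k ℕ.* ℓ)

    Φ-pred : ∀ k t → Φ (neg k) t ≈
      (sum {ℓ} (λ i → term (Φ (neg (suc k))) t (toℕ i)) + a ℓ t * Φ (neg (suc k)) t) + a (suc ℓ) t * Ψ (neg k) t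
    Φ-pred k t = trans
      (≡.subst (λ z → Φ z t ≈ up (Φ (neg (suc k))) t + a (suc ℓ) t * Ψ z t) (lemma (+ ℓ) (+ (k ℕ.* ℓ)))
        (Φ-recurrence (neg (suc k)) t))
      (+-congʳ (up-split (Φ (neg (suc k))) t))
      where
      lemma : ∀ ℓ k → ℤ.- (ℓ ℤ.+ k) ℤ.+ ℓ ≡ ℤ.- k
      lemma = solve-∀

    -- After multiplication by (-1)^t, `U-suc` has the coefficients of `Φ-pred` solved for its a_ℓ
    -- term. The hypotheses cover level `k` and the greater heights of level `suc k`.
    U≈Φ-suc : ∀ k t → (∀ s → sgn s * U k s ≈ Φ (neg k) s) →
      (∀ i → i ℕ.< ℓ → let s = t ℕ.+ (ℓ ℕ.∸ i) in sgn s * U (suc k) s ≈ Φ (neg (suc k)) s) →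
      sgn t * U (suc k) t ≈ Φ (neg (suc k)) t
    U≈Φ-suc k t U≈Φ U≈Φ-above = begin
      sgn t * U (suc k) t
        ≈⟨ *-congˡ (U-suc k t) ⟩
      sgn t * ((sum {ℓ} (λ i → dual-term k t (toℕ i)) + aℓ⁻¹ t * U k t) + a (suc ℓ) t * aℓ⁻¹ t * U⁻ k t)
        ≈⟨ trans (distribˡ _ _ _) (+-congʳ (distribˡ _ _ _)) ⟩
      (sgn t * sum {ℓ} (λ i → dual-term k t (toℕ i)) + sgn t * (aℓ⁻¹ t * U k t)) + sgn t * (a (suc ℓ) t * aℓ⁻¹ t * U⁻ k t)
        ≈⟨ +-cong (+-cong sum-part (trans (*-swap _ _ _) (*-congˡ (U≈Φ t)))) (down-part t) ⟩
      ((- 1# * aℓ⁻¹ t) * sum {ℓ} (λ i → term (Φ (neg (suc k))) t (toℕ i)) + aℓ⁻¹ t * Φ (neg k) t)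
        + (- 1# * aℓ⁻¹ t) * (a (suc ℓ) t * Ψ (neg k) t)
        ≈⟨ isolate-dual t (Φ-pred k t) ⟩
      Φ (neg (suc k)) t ∎
      where
      module CMS = CommutativeMonoidSolver *-commutativeMonoid
      open CMS using () renaming (_⊕_ to _⊕ᴹ_)

      term-part : ∀ i → i ℕ.< ℓ → sgn t * dual-term k t i ≈ (- 1# * aℓ⁻¹ t) * term (Φ (neg (suc k))) t i
      term-part i i<ℓ = begin
        sgn t * (sgn (ℓ ℕ.+ 1 ℕ.+ i) * α i t * aℓ⁻¹ t * u)
          ≈⟨ *-congˡ (*-congʳ (*-congʳ (*-congʳ (sgn-up i (ℕ.<⇒≤ i<ℓ))))) ⟩
        sgn t * ((- 1# * sgn d) * α i t * aℓ⁻¹ t * u)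
          ≈⟨ CMS.solve 6 (λ st m sd α r u → st ⊕ᴹ ((((m ⊕ᴹ sd) ⊕ᴹ α) ⊕ᴹ r) ⊕ᴹ u) CMS.⊜ (m ⊕ᴹ r) ⊕ᴹ (α ⊕ᴹ ((st ⊕ᴹ sd) ⊕ᴹ u)))
               refl (sgn t) (- 1#) (sgn d) (α i t) (aℓ⁻¹ t) u ⟩
        (- 1# * aℓ⁻¹ t) * (α i t * ((sgn t * sgn d) * u))
          ≈⟨ *-congˡ (*-congˡ (trans (*-congʳ (sym (sgn-+ t d))) (U≈Φ-above i i<ℓ))) ⟩
        (- 1# * aℓ⁻¹ t) * term (Φ (neg (suc k))) t i ∎
        where
        d = ℓ ℕ.∸ i
        u = U (suc k) (t ℕ.+ d)

      sum-part : sgn t * sum {ℓ} (λ i → dual-term k t (toℕ i)) ≈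
                 (- 1# * aℓ⁻¹ t) * sum {ℓ} (λ i → term (Φ (neg (suc k))) t (toℕ i))
      sum-part = trans (*-distribˡ-sum {ℓ} _ _) (trans (sum-cong-≋ {ℓ} λ i → term-part (toℕ i) (Fin.toℕ<n i))
        (sym (*-distribˡ-sum {ℓ} _ (λ i → term (Φ (neg (suc k))) t (toℕ i)))))

      -- The height `s` is separated from the coefficient index `t`, so that splitting on it leaves
      -- the coefficients alone.
      down-part : ∀ s → sgn s * (a (suc ℓ) t * aℓ⁻¹ t * U⁻ k s) ≈ (- 1# * aℓ⁻¹ t) * (a (suc ℓ) t * Ψ (neg k) s)
      down-part ℕ.zero  = trans (trans (*-congˡ (zeroʳ _)) (zeroʳ _)) (sym (trans (*-congˡ (zeroʳ _)) (zeroʳ _)))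
      down-part (suc s) = trans
        (CMS.solve 5 (λ m ss a r u → (m ⊕ᴹ ss) ⊕ᴹ ((a ⊕ᴹ r) ⊕ᴹ u) CMS.⊜ (m ⊕ᴹ r) ⊕ᴹ (a ⊕ᴹ (ss ⊕ᴹ u)))
          refl (- 1#) (sgn s) (a (suc ℓ) t) (aℓ⁻¹ t) (U k s))
        (*-congˡ (*-congˡ (U≈Φ s)))

    U≈Φ-above : ∀ k t → k ℕ.< t → sgn t * U k t ≈ Φ (neg k) t
    U≈Φ-above k t k<t = trans (trans (*-congˡ (U-vanishes k t k<t)) (zeroʳ _)) (sym (Φ-vanishes k t k<t))

    U≈Φ : ∀ k t → sgn t * U k t ≈ Φ (neg k) t
    U≈Φ ℕ.zero  ℕ.zero  = trans (trans (*-identityˡ _) U-0-0) (sym Φ-0-0)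
    U≈Φ ℕ.zero  (suc t) = U≈Φ-above 0 (suc t) (ℕ.s≤s ℕ.z≤n)
    U≈Φ (suc k) t       = descend (suc (suc k)) t (ℕ.m≤n+m (suc (suc k)) t)
      where
      -- Induction on height from above: at `d = 0` the height is in the range where both sides
      -- vanish. An ascending step gains at least 1, which pays for lowering `d`; the initial k + 2
      -- suffices for every `t`.
      descend : ∀ d t → suc k ℕ.< t ℕ.+ d → sgn t * U (suc k) t ≈ Φ (neg (suc k)) t
      descend ℕ.zero  t k<t+d = U≈Φ-above (suc k) t (≡.subst (suc k ℕ.<_) (ℕ.+-identityʳ t) k<t+d)
      descend (suc d) t k<t+d = U≈Φ-suc k t (U≈Φ k) λ i i<ℓ → descend d (t ℕ.+ (ℓ ℕ.∸ i))
        (ℕ.<-≤-trans k<t+d (ℕ.≤-trans (ℕ.+-monoʳ-≤ t (ℕ.+-monoˡ-≤ d (ℕ.m<n⇒0<n∸m i<ℓ)))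
          (ℕ.≤-reflexive (≡.sym (ℕ.+-assoc t (ℓ ℕ.∸ i) d)))))

    -- Division with remainder gives -n = -kℓ + s, so x^(-n) is x^(-kℓ) P_s and `pt k s` has
    -- x-coordinate 0.
    moment : L (x^ (ℤ.- + n)) ≈ sgn ((ℤ.- + n) %ℕ ℓ) * w𝓑̃ n
    moment = begin
      L (x^ (ℤ.- + n))
        ≡⟨ ≡.cong (λ i → L (x^ i)) (≡.trans division (ℤ.+-comm (+ s) (neg k))) ⟩
      L (x^ (neg k ℤ.+ + s))
        ≈⟨ Φ-moment (neg k) s (ℤ.n%ℕd<d (ℤ.- + n) ℓ) ⟨
      Φ (neg k) s
        ≈⟨ U≈Φ k s ⟨
      sgn s * U k s
        ≡⟨ ≡.cong (λ x → sgn s * W (x , + s) target) start≡0 ⟩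
      sgn s * W (0ℤ , + s) target
        ≈⟨ *-congˡ (W-totalWeight (𝓑̃-enum ℓ n)) ⟩
      sgn s * w𝓑̃ n ∎
      where
      s = (ℤ.- + n) %ℕ ℓ
      k = ∣ (ℤ.- + n) /ℕ ℓ ∣
      q = (ℤ.- + n) /ℕ ℓ
      q≤0 : q ℤ.≤ 0ℤ
      -- From qℓ ≤ -n ≤ 0 and ℓ > 0; hence `k`, defined as an absolute value, is -q.
      q≤0 = ℤ.*-cancelʳ-≤-pos q 0ℤ (+ ℓ) {{ℤ.positive (ℤ.+<+ (ℕ.>-nonZero⁻¹ ℓ))}}
        (ℤ.≤-trans (ℤ.[n/ℕd]*d≤n (ℤ.- + n) ℓ) (ℤ.neg-mono-≤ (ℤ.+≤+ (ℕ.z≤n {n}))))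
      +k≡-q : + k ≡ ℤ.- q
      +k≡-q = ≡.trans (≡.cong +_ (≡.sym (ℤ.∣-i∣≡∣i∣ q))) (ℤ.0≤i⇒+∣i∣≡i (ℤ.neg-mono-≤ q≤0))
      neg-k : neg k ≡ q ℤ.* + ℓ
      neg-k = ≡.trans (≡.cong ℤ.-_ (≡.trans (ℤ.pos-* k ℓ) (≡.cong (ℤ._* + ℓ) +k≡-q))) (lemma q (+ ℓ))
        where
        lemma : ∀ q ℓ → ℤ.- (ℤ.- q ℤ.* ℓ) ≡ q ℤ.* ℓ
        lemma = solve-∀
      division : ℤ.- + n ≡ + s ℤ.+ neg k
      division = ≡.trans (ℤ.a≡a%ℕn+[a/ℕn]*n (ℤ.- + n) ℓ) (≡.cong (ℤ._+_ (+ s)) (≡.sym neg-k))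
      start≡0 : (+ n ℤ.- + (k ℕ.* ℓ)) ℤ.+ + s ≡ 0ℤ
      start≡0 = ≡.trans (lemma (+ n) (neg k) (+ s))
        (≡.trans (≡.cong (ℤ._+_ (+ n)) (≡.sym division)) (ℤ.+-inverseʳ (+ n)))
        where
        lemma : ∀ n k s → (n ℤ.+ k) ℤ.+ s ≡ n ℤ.+ (s ℤ.+ k)
        lemma = solve-∀

-- The three ranges of exponents.

theorem3p2 :
    ∀ {c r₁ r₂} (K : HeytingField c r₁ r₂) →
    let open HeytingField K
        open OverField K in
    (ℓ : ℕ) .{{_ : NonZero ℓ}}
    (a : ℕ → ℕ → Carrier)
    (aℓ#0 : ∀ j → a ℓ j # 0#)
    (aℓ₊₁#0 : ∀ j → a (suc ℓ) j # 0#)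
    (P : ℤ → Laurent) →
    IsRecurrenceSolution ℓ a P →
    (L : Laurent → Carrier) →
    IsLinearFunctional L →
    IsLBP ℓ (λ n → P (+ n)) L →
    L (const 1#) ≈ 1# →
    let open Weights ℓ a aℓ#0
        μ : ℤ → Carrier
        μ n = L (x^ n) in
    ∀ (n : ℤ) →
      (+ ℓ ℤ.≤ n → μ n ≈ a ℓ 0 * w𝓑 ∣ n ℤ.- + ℓ ∣)
      × (1ℤ ℤ.≤ n → n ℤ.≤ + ℓ ℤ.- 1ℤ → μ n ≈ 0#)
      × (n ℤ.≤ 0ℤ → μ n ≈ sgn (n %ℕ ℓ) * w𝓑̃ ∣ ℤ.- n ∣)
theorem3p2 K ℓ a aℓ#0 _ P solution L linear lbp L1≈1 n = large , small , nonpositive n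
  where
  open HeytingField K
  open OverField K
  open Weights ℓ a aℓ#0
  open Moments K ℓ a P solution L linear lbp L1≈1 using (Φ-moment; Φ-vanishes)
  open MomentFormulas K ℓ a aℓ#0 P solution L linear lbp L1≈1

  large : + ℓ ℤ.≤ n → L (x^ n) ≈ a ℓ 0 * w𝓑 ∣ n ℤ.- + ℓ ∣
  large ℓ≤n = ≡.subst (λ i → L (x^ i) ≈ a ℓ 0 * w𝓑 ∣ n ℤ.- + ℓ ∣)
    (≡.trans (≡.cong (ℤ._+ + ℓ) (ℤ.0≤i⇒+∣i∣≡i (ℤ.i≤j⇒0≤j-i ℓ≤n))) (lemma n (+ ℓ)))
    (Positive.moment ∣ n ℤ.- + ℓ ∣)
    where
    lemma : ∀ n ℓ → (n ℤ.+ ℤ.- ℓ) ℤ.+ ℓ ≡ n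
    lemma = solve-∀

  small : 1ℤ ℤ.≤ n → n ℤ.≤ + ℓ ℤ.- 1ℤ → L (x^ n) ≈ 0#
  -- For 0 < t < ℓ the monomial x^t is P_t, which is orthogonal to 1.
  small (ℤ.+≤+ {n = t} 0<t) n≤ℓ-1 = trans (sym (Φ-moment 0ℤ t t<ℓ)) (Φ-vanishes 0 t 0<t)
    where
    t<ℓ : t ℕ.< ℓ
    t<ℓ = ℤ.drop‿+<+ (ℤ.i≤pred[j]⇒i<j (≡.subst (+ t ℤ.≤_) (ℤ.+-comm (+ ℓ) -1ℤ) n≤ℓ-1))

  nonpositive : ∀ n → n ℤ.≤ 0ℤ → L (x^ n) ≈ sgn (n %ℕ ℓ) * w𝓑̃ ∣ ℤ.- n ∣
  -- Splitting on the exponent makes its negation compute, so that the formula for x^(-m) applies as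
  -- it stands.
  nonpositive (+ 0)     _ = Negative.moment 0
  nonpositive (+ suc _) (ℤ.+≤+ ())
  nonpositive -[1+ m ]  _ = Negative.moment (suc m)
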